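{- Let $\Phi=(A;\{E_i\}_{i=0}^d;A^*;\{E^*_i\}_{i=0}^d)$ be a Leonard system on $V$, with $d\ge 3$ and with $\mathbb F$ algebraically closed. Assume that $\Phi$ has one of the following types: dual $q$-Krawtchouk, Hahn, Krawtchouk. Then the zero diagonal space satisfies ${\mathcal Z}(\Phi)\neq 0$.
   Context: Let $\mathbb F$ be an algebraically closed field and $V$ a vector space over $\mathbb F$ of dimension $d+1$ with $d\ge 3$. "Scalar" means element of $\mathbb F$; integers appearing in formulas are read in $\mathbb F$. A tridiagonal matrix is irreducible if all entries on its subdiagonal and superdiagonal are nonzero. A Leonard pair on $V$ is an ordered pair $A,A^*\in \mathrm{End}(V)$ such that (i) there is a basis of $V$ with respect to which $A$ is irreducible tridiagonal and $A^*$ is diagonal; (ii) there is a basis of $V$ with respect to which $A^*$ is irreducible tridiagonal and $A$ is diagonal. Then $A,A^*$ are multiplicity-free (diagonalizable with one-dimensional eigenspaces). The primitive idempotent of $A$ for an eigenvalue $\theta$ is the projection onto the $\theta$-eigenspace along the sum of the other eigenspaces. An ordering $\{\theta_i\}_{i=0}^d$ of the eigenvalues of $A$ (and the corresponding ordering $\{E_i\}_{i=0}^d$ of primitive idempotents) is standard if corresponding eigenvectors $v_0,\dots,v_d$, in this order, form a basis as in (ii). Standard orderings for $A^*$ are defined similarly using (i). A Leonard system on $V$ is a sequence $\Phi=(A;\{E_i\}_{i=0}^d;A^*;\{E^*_i\}_{i=0}^d)$ where $A,A^*$ is a Leonard pair on $V$ and $\{E_i\}$, $\{E^*_i\}$ are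 standard orderings of the primitive idempotents of $A$, $A^*$. Parameter array: $\theta_i$ (resp. $\theta^*_i$) is the eigenvalue of $A$ (resp. $A^*$) for $E_i$ (resp. $E^*_i$). For $0\ne u\in E^*_0V$ the vectors $u_i=(A-\theta_0I)\cdots(A-\theta_{i-1}I)u$ $(0\le i\le d)$ form a basis of $V$, and $A^*u_0=\theta^*_0u_0$, $A^*u_i=\theta^*_iu_i+\varphi_iu_{i-1}$ $(1\le i\le d)$ for nonzero scalars $\varphi_i$; $\{\varphi_i\}_{i=1}^d$ is the first split sequence of $\Phi$. The second split sequence $\{\phi_i\}_{i=1}^d$ is the first split sequence of the Leonard system $(A;\{E_{d-i}\}_{i=0}^d;A^*;\{E^*_i\}_{i=0}^d)$. Zero diagonal space: ${\mathcal Z}(\Phi)$ is the set of $X\in\mathrm{Span}\{I,A^*,A,AA^*\}$ such that $E^*_iXE^*_i=0$ for $0\le i\le d$. Types: Dual $q$-Krawtchouk type: there exist nonzero scalars $q,h,h^*,s$ with $q^i\ne1$ $(1\le i\le d)$, $sq^i\neq 1$ $(2\le i\le 2d)$, such that $\theta_i=\theta_0+h(1-q^i)(1-sq^{i+1})q^{ -i}$, $\theta^*_i=\theta^*_0+h^*(1-q^i)q^{ -i}$ $(0\le i\le d)$; $\varphi_i=hh^*q^{1-2i}(1-q^i)(1-q^{i-d-1})$, $\phi_i=hh^*sq^{d+2-2i}(1-q^i)(1-q^{i-d-1})$ $(1\le i\le d)$. Hahn type: there exist scalars $h^*,s,s^*,r$ with $h^*,s$ nonzero; $\mathrm{char}\,\mathbb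 F$ is $0$ or a prime greater than $d$; neither of $r,\,s^*-r$ equals $-i$ for $1\le i\le d$; $s^*\ne -i$ for $2\le i\le 2d$; $\theta_i=\theta_0+si$, $\theta^*_i=\theta^*_0+h^*i(i+1+s^*)$ $(0\le i\le d)$; $\varphi_i=h^*si(i-d-1)(i+r)$, $\phi_i=-h^*si(i-d-1)(i+s^*-r)$ $(1\le i\le d)$. Krawtchouk type: there exist nonzero scalars $s,s^*,r$ with $\mathrm{char}\,\mathbb F$ equal to $0$ or a prime greater than $d$; $r\ne ss^*$; $\theta_i=\theta_0+si$, $\theta^*_i=\theta^*_0+s^*i$ $(0\le i\le d)$; $\varphi_i=ri(i-d-1)$, $\phi_i=(r-ss^*)i(i-d-1)$ $(1\le i\le d)$. -}

module Defs where

open import Level using (_⊔_) renaming (suc to lsuc)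
open import Algebra.Bundles using (CommutativeMonoid; CommutativeRing; Semiring)
open import Algebra.Module.Bundles using (LeftModule)
import Algebra.Definitions
import Algebra.Definitions.RawMonoid
import Algebra.Definitions.RawSemiring
import Algebra.Module.Morphism.Structures
import Algebra.Module.Morphism.Construct.Composition as Composition
import Algebra.Module.Morphism.Construct.Identity as Identity
import Algebra.Module.Properties.LeftModule
import Algebra.Properties.CommutativeSemigroup
import Relation.Binary.Reasoning.Setoid
open import Data.Nat.Base as ℕ using (ℕ; suc; ∣_-_∣)
open import Data.Nat.Divisibility using (_∣_)
open import Data.Nat.Primality using (Prime)
open import Data.Integer.Base as ℤ using (ℤ; +_; -[1+_])
open import Data.Fin.Base using (Fin; zero; suc; toℕ; inject; inject₁; opposite)
open import Data.Vec.Functional as Vector using (Vector)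
open import Data.Product.Base using (Σ; ∃; _×_; _,_; proj₁)
open import Data.Sum.Base using (_⊎_)
open import Function.Base using (_∘_)
open import Function.Bundles using (_⇔_)
open import Relation.Binary.PropositionalEquality.Core using (_≡_; _≢_)
open import Relation.Nullary.Negation using (¬_)

-- Equality is a setoid equality and "nonzero" is its negation; decidability
-- of equality is not assumed.

record Field c ℓ : Set (lsuc (c ⊔ ℓ)) where
  field
    commutativeRing : CommutativeRing c ℓ
  open CommutativeRing commutativeRing public
  open Algebra.Definitions _≈_ using (Invertible)
  field
    1≉0     : 1# ≉ 0#
    inverse : ∀ x → x ≉ 0# → Invertible 1# _*_ x

module FieldNotions {c ℓ} (F : Field c ℓ) where
  open Field F
  open Algebra.Definitions.RawSemiring (Semiring.rawSemiring semiring) public using (_^_)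
  open Algebra.Definitions.RawMonoid +-rawMonoid using (sum)
    renaming (_×_ to _×ⁿ_)

  ⟦_⟧ : ℕ → Carrier
  ⟦ n ⟧ = n ×ⁿ 1#

  zpow : (x : Carrier) → x ≉ 0# → ℤ → Carrier
  zpow x x≉0 (+ n)     = x ^ n
  zpow x x≉0 -[1+ n ]  = proj₁ (inverse x x≉0) ^ suc n

  eval : ∀ {n} → Vector Carrier n → Carrier → Carrier
  eval a x = sum λ i → a i * x ^ toℕ i

  IsAlgebraicallyClosed : Set (c ⊔ ℓ)
  IsAlgebraicallyClosed =
    ∀ n (a : Vector Carrier (suc (suc n))) →
    Vector.last a ≉ 0# → ∃ λ x → eval a x ≈ 0#

  HasCharacteristic : ℕ → Set ℓ
  HasCharacteristic p = ∀ n → (⟦ n ⟧ ≈ 0#) ⇔ (p ∣ n)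

  Char0OrPrime> : ℕ → Set ℓ
  Char0OrPrime> d =
    ∃ λ p → HasCharacteristic p × (p ≡ 0 ⊎ (Prime p × d ℕ.< p))

  Matrix : ℕ → Set c
  Matrix n = Fin n → Fin n → Carrier

  IsDiagonal : ∀ {n} → Matrix n → Set ℓ
  IsDiagonal M = ∀ i j → i ≢ j → M i j ≈ 0#

  record IsIrreducibleTridiagonal {n} (M : Matrix n) : Set ℓ where
    field
      tridiagonal : ∀ i j → 1 ℕ.< ∣ toℕ i - toℕ j ∣ → M i j ≈ 0#
      irreducible : ∀ i j → ∣ toℕ i - toℕ j ∣ ≡ 1 → M i j ≉ 0#

VectorSpace : ∀ {c ℓ} → Field c ℓ → ∀ m ℓm → Set (c ⊔ ℓ ⊔ lsuc (m ⊔ ℓm))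
VectorSpace F m ℓm = LeftModule (Field.ring F) m ℓm

module LinearAlgebra {c ℓ m ℓm} (F : Field c ℓ) (V : VectorSpace F m ℓm) where
  open Field F
  open FieldNotions F
  open LeftModule V
  open Algebra.Definitions.RawMonoid +ᴹ-rawMonoid public using ()
    renaming (sum to sumᴹ)

  infixl 6 _-ᴹ_
  _-ᴹ_ : Carrierᴹ → Carrierᴹ → Carrierᴹ
  v -ᴹ w = v +ᴹ (-ᴹ w)

  linearCombination : ∀ {n} → Vector Carrier n → Vector Carrierᴹ n → Carrierᴹ
  linearCombination a b = sumᴹ λ i → a i *ₗ b i

  record IsBasis {n} (b : Vector Carrierᴹ n) : Set (c ⊔ ℓ ⊔ m ⊔ ℓm) where
    field
      independent : ∀ a → linearCombination a b ≈ᴹ 0ᴹ → ∀ i → a i ≈ 0#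
      spanning    : ∀ v → ∃ λ a → v ≈ᴹ linearCombination a b

  HasDimension : ℕ → Set (c ⊔ ℓ ⊔ m ⊔ ℓm)
  HasDimension n = Σ (Vector Carrierᴹ n) IsBasis

  open Algebra.Module.Morphism.Structures.LeftModuleMorphisms rawLeftModule rawLeftModule

  record End : Set (c ⊔ m ⊔ ℓm) where
    infixr 9 _$_
    field
      _$_      : Carrierᴹ → Carrierᴹ
      isLinear : IsLeftModuleHomomorphism _$_
    open IsLeftModuleHomomorphism isLinear public
      using (⟦⟧-cong; +ᴹ-homo; *ₗ-homo; 0ᴹ-homo; -ᴹ-homo)

  open End public using (_$_)

  infix 4 _≈ₑ_
  _≈ₑ_ : End → End → Set (m ⊔ ℓm)
  X ≈ₑ Y = ∀ v → X $ v ≈ᴹ Y $ v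

  private
    mkEnd : (f : Carrierᴹ → Carrierᴹ) →
            (∀ {v w} → v ≈ᴹ w → f v ≈ᴹ f w) →
            (∀ v w → f (v +ᴹ w) ≈ᴹ f v +ᴹ f w) →
            (∀ x v → f (x *ₗ v) ≈ᴹ x *ₗ f v) → End
    mkEnd f cong add scale = record
      { _$_      = f
      ; isLinear = record
        { +ᴹ-isGroupHomomorphism = record
          { isMonoidHomomorphism = record
            { isMagmaHomomorphism = record
              { isRelHomomorphism = record { cong = cong }
              ; homo              = add
              }
            ; ε-homo = f0≈0
            }
          ; ⁻¹-homo = λ v → inverseˡ-uniqueᴹ (f (-ᴹ v)) (f v) (begin
              f (-ᴹ v) +ᴹ f v  ≈⟨ add (-ᴹ v) v ⟨
              f (-ᴹ v +ᴹ v)    ≈⟨ cong (-ᴹ‿inverseˡ v) ⟩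
              f 0ᴹ             ≈⟨ f0≈0 ⟩
              0ᴹ               ∎)
          }
        ; *ₗ-homo = scale
        }
      }
      where
      open Relation.Binary.Reasoning.Setoid ≈ᴹ-setoid
      open Algebra.Module.Properties.LeftModule V using (inverseˡ-uniqueᴹ)
      f0≈0 : f 0ᴹ ≈ᴹ 0ᴹ
      f0≈0 = begin
        f 0ᴹ          ≈⟨ cong (*ₗ-zeroˡ 0ᴹ) ⟨
        f (0# *ₗ 0ᴹ)  ≈⟨ scale 0# 0ᴹ ⟩
        0# *ₗ f 0ᴹ    ≈⟨ *ₗ-zeroˡ (f 0ᴹ) ⟩
        0ᴹ            ∎

  idₑ : End
  idₑ = record { isLinear = Identity.isLeftModuleHomomorphism rawLeftModule ≈ᴹ-refl }

  infixr 9 _∘ₑ_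
  _∘ₑ_ : End → End → End
  X ∘ₑ Y = record
    { isLinear = Composition.isLeftModuleHomomorphism ≈ᴹ-trans
        (End.isLinear Y) (End.isLinear X)
    }

  0ₑ : End
  0ₑ = mkEnd (λ _ → 0ᴹ) (λ _ → ≈ᴹ-refl)
    (λ _ _ → ≈ᴹ-sym (+ᴹ-identityˡ 0ᴹ)) (λ x _ → ≈ᴹ-sym (*ₗ-zeroʳ x))

  infixl 6 _+ₑ_
  _+ₑ_ : End → End → End
  X +ₑ Y = mkEnd (λ v → X $ v +ᴹ Y $ v)
    (λ v≈w → +ᴹ-cong (X.⟦⟧-cong v≈w) (Y.⟦⟧-cong v≈w))
    (λ v w → ≈ᴹ-trans (+ᴹ-cong (X.+ᴹ-homo v w) (Y.+ᴹ-homo v w))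
      (interchange (X $ v) (X $ w) (Y $ v) (Y $ w)))
    (λ x v → ≈ᴹ-trans (+ᴹ-cong (X.*ₗ-homo x v) (Y.*ₗ-homo x v))
      (≈ᴹ-sym (*ₗ-distribˡ x (X $ v) (Y $ v))))
    where
    module X = End X
    module Y = End Y
    open Algebra.Properties.CommutativeSemigroup
      (CommutativeMonoid.commutativeSemigroup +ᴹ-commutativeMonoid)
      using (interchange)

  infixr 7 _·ₑ_
  _·ₑ_ : Carrier → End → End
  a ·ₑ X = mkEnd (λ v → a *ₗ X $ v)
    (λ v≈w → *ₗ-cong refl (X.⟦⟧-cong v≈w))
    (λ v w → ≈ᴹ-trans (*ₗ-cong refl (X.+ᴹ-homo v w))
      (*ₗ-distribˡ a (X $ v) (X $ w)))
    (λ x v → begin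
      a *ₗ X $ (x *ₗ v)    ≈⟨ *ₗ-cong refl (X.*ₗ-homo x v) ⟩
      a *ₗ (x *ₗ X $ v)    ≈⟨ *ₗ-assoc a x (X $ v) ⟨
      (a * x) *ₗ X $ v     ≈⟨ *ₗ-cong (*-comm a x) ≈ᴹ-refl ⟩
      (x * a) *ₗ X $ v     ≈⟨ *ₗ-assoc x a (X $ v) ⟩
      x *ₗ (a *ₗ X $ v)    ∎)
    where
    module X = End X
    open Relation.Binary.Reasoning.Setoid ≈ᴹ-setoid

  IsMatrixOf : ∀ {n} → Vector Carrierᴹ n → End → Matrix n → Set ℓm
  IsMatrixOf b X M = ∀ j → X $ b j ≈ᴹ linearCombination (λ i → M i j) b

  Eigenspace : End → Carrier → Carrierᴹ → Set ℓm
  Eigenspace X θ v = X $ v ≈ᴹ θ *ₗ v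

  IsEigenvector : End → Carrier → Carrierᴹ → Set ℓm
  IsEigenvector X θ v = v ≉ᴹ 0ᴹ × Eigenspace X θ v

  IsEigenvalue : End → Carrier → Set (m ⊔ ℓm)
  IsEigenvalue X θ = ∃ λ v → IsEigenvector X θ v

  SumOfOtherEigenspaces : End → Carrier → Carrierᴹ → Set (c ⊔ ℓ ⊔ m ⊔ ℓm)
  SumOfOtherEigenspaces X θ v =
    ∃ λ n → Σ (Vector Carrier n) λ η → Σ (Vector Carrierᴹ n) λ w →
    (∀ k → η k ≉ θ × Eigenspace X (η k) (w k)) × v ≈ᴹ sumᴹ w

  record IsProjection {p q} (E : End)
                      (Onto : Carrierᴹ → Set p) (Along : Carrierᴹ → Set q) :
                      Set (m ⊔ ℓm ⊔ p ⊔ q) where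
    field
      image  : ∀ v → Onto (E $ v)
      fixes  : ∀ v → Onto v → E $ v ≈ᴹ v
      kernel : ∀ v → (E $ v ≈ᴹ 0ᴹ) ⇔ Along v

  IsPrimitiveIdempotent : End → Carrier → End → Set (c ⊔ ℓ ⊔ m ⊔ ℓm)
  IsPrimitiveIdempotent X θ E =
    IsEigenvalue X θ ×
    IsProjection E (Eigenspace X θ) (SumOfOtherEigenspaces X θ)

  record IsEigenvalueOrdering {n} (X : End) (θ : Vector Carrier n) :
                              Set (c ⊔ ℓ ⊔ m ⊔ ℓm) where
    field
      eigenvalue : ∀ i → IsEigenvalue X (θ i)
      distinct   : ∀ i j → i ≢ j → θ i ≉ θ j
      exhaustive : ∀ η → IsEigenvalue X η → ∃ λ i → η ≈ θ i

module Leonard {c ℓ m ℓm} (F : Field c ℓ) (V : VectorSpace F m ℓm) where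
  open Field F hiding (zero)
  open FieldNotions F
  open LeftModule V
  open LinearAlgebra F V public

  record IsTridiagonalDiagonalBasis {n} (X Y : End) (b : Vector Carrierᴹ n) :
                                    Set (c ⊔ ℓ ⊔ m ⊔ ℓm) where
    field
      isBasis      : IsBasis b
      tridiagonalX : ∃ λ M → IsMatrixOf b X M × IsIrreducibleTridiagonal M
      diagonalY    : ∃ λ M → IsMatrixOf b Y M × IsDiagonal M

  record IsLeonardPair (d : ℕ) (A A* : End) : Set (c ⊔ ℓ ⊔ m ⊔ ℓm) where
    field
      basis  : Σ (Vector Carrierᴹ (suc d)) (IsTridiagonalDiagonalBasis A A*)
      basis* : Σ (Vector Carrierᴹ (suc d)) (IsTridiagonalDiagonalBasis A* A)

  IsStandardOrdering : ∀ {n} (X Y : End) → Vector Carrier n →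
                       Set (c ⊔ ℓ ⊔ m ⊔ ℓm)
  IsStandardOrdering X Y θ =
    IsEigenvalueOrdering X θ ×
    ∃ λ v → (∀ i → IsEigenvector X (θ i) (v i)) ×
            IsTridiagonalDiagonalBasis Y X v

  -- A Leonard system is the sequence (A; E; A*; E*); the eigenvalues θ and θ*
  -- are carried along for convenience, and are determined by the rest.

  record RawLeonardSystem (d : ℕ) : Set (c ⊔ m ⊔ ℓm) where
    field
      A  : End
      E  : Vector End (suc d)
      A* : End
      E* : Vector End (suc d)
      θ  : Vector Carrier (suc d)
      θ* : Vector Carrier (suc d)

  record IsLeonardSystem {d} (Φ : RawLeonardSystem d) :
                         Set (c ⊔ ℓ ⊔ m ⊔ ℓm) where
    open RawLeonardSystem Φ
    field
      isLeonardPair          : IsLeonardPair d A A*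
      isStandardOrdering     : IsStandardOrdering A A* θ
      isStandardOrdering*    : IsStandardOrdering A* A θ*
      isPrimitiveIdempotent  : ∀ i → IsPrimitiveIdempotent A (θ i) (E i)
      isPrimitiveIdempotent* : ∀ i → IsPrimitiveIdempotent A* (θ* i) (E* i)

  record LeonardSystem (d : ℕ) : Set (c ⊔ ℓ ⊔ m ⊔ ℓm) where
    field
      raw             : RawLeonardSystem d
      isLeonardSystem : IsLeonardSystem raw
    open RawLeonardSystem raw public
    open IsLeonardSystem isLeonardSystem public

  -- The reverse of a standard ordering is standard, so ⇓ preserves Leonard
  -- systems.

  _⇓ : ∀ {d} → RawLeonardSystem d → RawLeonardSystem d
  Φ ⇓ = record { A = A ; E = E ∘ opposite ; A* = A* ; E* = E*
               ; θ = θ ∘ opposite ; θ* = θ* }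
    where open RawLeonardSystem Φ

  -- The i-th entry is (A - θ₀ I) ⋯ (A - θᵢ₋₁ I) u.

  splitVector : ∀ {n} → End → Vector Carrier n → Carrierᴹ → Vector Carrierᴹ n
  splitVector A θ u i =
    Vector.foldr (λ t v → A $ v -ᴹ t *ₗ v) u
                 (λ (k : Fin (toℕ i)) → θ (inject {i = i} k))

  -- Split sequences are indexed from 1 to d, so the scalar with index i + 1 is
  -- the value at i : Fin d.  For a Leonard system the splitVectors form a
  -- basis, hence these equations determine the sequence, and its terms are
  -- nonzero.

  IsFirstSplitSequence : ∀ {d} → RawLeonardSystem d → Vector Carrier d →
                         Set (m ⊔ ℓm)
  IsFirstSplitSequence {d} Φ φ =
    ∀ u → u ≉ᴹ 0ᴹ → (∃ λ v → u ≈ᴹ E* zero $ v) →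
    let uᵢ = splitVector A θ u in
    ∀ (i : Fin d) →
    A* $ uᵢ (suc i) ≈ᴹ θ* (suc i) *ₗ uᵢ (suc i) +ᴹ φ i *ₗ uᵢ (inject₁ i)
    where open RawLeonardSystem Φ

  record SplitSequences {d} (Φ : LeonardSystem d) : Set (c ⊔ m ⊔ ℓm) where
    open LeonardSystem Φ using (raw)
    field
      first    : Vector Carrier d
      second   : Vector Carrier d
      isFirst  : IsFirstSplitSequence raw first
      isSecond : IsFirstSplitSequence (raw ⇓) second

  InSpan₄ : (X₀ X₁ X₂ X₃ X : End) → Set (c ⊔ m ⊔ ℓm)
  InSpan₄ X₀ X₁ X₂ X₃ X =
    ∃ λ a₀ → ∃ λ a₁ → ∃ λ a₂ → ∃ λ a₃ →
    X ≈ₑ a₀ ·ₑ X₀ +ₑ a₁ ·ₑ X₁ +ₑ a₂ ·ₑ X₂ +ₑ a₃ ·ₑ X₃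

  ZeroDiagonalSpace : ∀ {d} → LeonardSystem d → End → Set (c ⊔ m ⊔ ℓm)
  ZeroDiagonalSpace Φ X =
    InSpan₄ idₑ A* A (A ∘ₑ A*) X × (∀ i → E* i ∘ₑ X ∘ₑ E* i ≈ₑ 0ₑ)
    where open LeonardSystem Φ

  ZeroDiagonalSpaceNonzero : ∀ {d} → LeonardSystem d → Set (c ⊔ m ⊔ ℓm)
  ZeroDiagonalSpaceNonzero Φ =
    ∃ λ X → ZeroDiagonalSpace Φ X × ¬ (X ≈ₑ 0ₑ)

  module _ {d} (Φ : LeonardSystem d) (split : SplitSequences Φ) where
    open LeonardSystem Φ
    open SplitSequences split renaming (first to varphi; second to phi)

    private
      θ₀ θ₀* : Carrier
      θ₀  = θ zero
      θ₀* = θ* zero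

      dᶠ : Carrier
      dᶠ = ⟦ d ⟧

      [_] : Fin d → ℕ
      [ i ] = suc (toℕ i)

      [_]ᶠ : Fin d → Carrier
      [ i ]ᶠ = ⟦ [ i ] ⟧

    record IsDualqKrawtchouk : Set (c ⊔ ℓ) where
      field
        q h h* s : Carrier
        q≉0      : q ≉ 0#
        h≉0      : h ≉ 0#
        h*≉0     : h* ≉ 0#
        s≉0      : s ≉ 0#

      q^ : ℤ → Carrier
      q^ = zpow q q≉0

      field
        qⁱ≉1  : ∀ i → 1 ℕ.≤ i → i ℕ.≤ d → q ^ i ≉ 1#
        sqⁱ≉1 : ∀ i → 2 ℕ.≤ i → i ℕ.≤ 2 ℕ.* d → s * q ^ i ≉ 1#
        θ-eq  : ∀ k → let i = + toℕ k in
          θ k ≈ θ₀ + h * (1# - q^ i) * (1# - s * q^ (i ℤ.+ + 1)) * q^ (ℤ.- i)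
        θ*-eq : ∀ k → let i = + toℕ k in
          θ* k ≈ θ₀* + h* * (1# - q^ i) * q^ (ℤ.- i)
        varphi-eq : ∀ k → let i = + [ k ] in
          varphi k ≈ h * h* * q^ (+ 1 ℤ.- + 2 ℤ.* i) * (1# - q^ i)
                     * (1# - q^ (i ℤ.- + d ℤ.- + 1))
        phi-eq : ∀ k → let i = + [ k ] in
          phi k ≈ h * h* * s * q^ (+ d ℤ.+ + 2 ℤ.- + 2 ℤ.* i) * (1# - q^ i)
                  * (1# - q^ (i ℤ.- + d ℤ.- + 1))

    record IsHahn : Set (c ⊔ ℓ) where
      field
        h* s s* r : Carrier
        h*≉0      : h* ≉ 0#
        s≉0       : s ≉ 0#
        char      : Char0OrPrime> d
        r≉-i      : ∀ i → 1 ℕ.≤ i → i ℕ.≤ d → r ≉ - ⟦ i ⟧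
        s*-r≉-i   : ∀ i → 1 ℕ.≤ i → i ℕ.≤ d → s* - r ≉ - ⟦ i ⟧
        s*≉-i     : ∀ i → 2 ℕ.≤ i → i ℕ.≤ 2 ℕ.* d → s* ≉ - ⟦ i ⟧
        θ-eq      : ∀ k → let i = ⟦ toℕ k ⟧ in θ k ≈ θ₀ + s * i
        θ*-eq     : ∀ k → let i = ⟦ toℕ k ⟧ in
          θ* k ≈ θ₀* + h* * i * (i + 1# + s*)
        varphi-eq : ∀ k → let i = [ k ]ᶠ in
          varphi k ≈ h* * s * i * (i - dᶠ - 1#) * (i + r)
        phi-eq    : ∀ k → let i = [ k ]ᶠ in
          phi k ≈ - (h* * s * i * (i - dᶠ - 1#) * (i + s* - r))

    record IsKrawtchouk : Set (c ⊔ ℓ) where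
      field
        s s* r    : Carrier
        s≉0       : s ≉ 0#
        s*≉0      : s* ≉ 0#
        r≉0       : r ≉ 0#
        char      : Char0OrPrime> d
        r≉ss*     : r ≉ s * s*
        θ-eq      : ∀ k → let i = ⟦ toℕ k ⟧ in θ k ≈ θ₀ + s * i
        θ*-eq     : ∀ k → let i = ⟦ toℕ k ⟧ in θ* k ≈ θ₀* + s* * i
        varphi-eq : ∀ k → let i = [ k ]ᶠ in
          varphi k ≈ r * i * (i - dᶠ - 1#)
        phi-eq    : ∀ k → let i = [ k ]ᶠ in
          phi k ≈ (r - s * s*) * i * (i - dᶠ - 1#)

{-# OPTIONS --safe #-}
module Submission where

-- Let A have diagonal entries aᵢ in an eigenbasis of A*.  An element
-- x₀ I + x₁ A* + x₂ A + x₃ A A* has zero diagonal exactly when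
-- (x₀ + x₁ θ*ᵢ) + (x₂ + x₃ θ*ᵢ) aᵢ = 0 for all i, so it suffices that aᵢ is a
-- quotient of two affine functions of θ*ᵢ.  Comparing two coefficients of the
-- split vectors in the eigenbasis gives
--   aᵢ = θᵢ + φᵢ / (θ*ᵢ - θ*ᵢ₋₁) - φᵢ₊₁ / (θ*ᵢ₊₁ - θ*ᵢ),
-- and for each of the three types this simplifies to such a quotient, whose
-- denominator is constant (Krawtchouk), proportional to q⁻ⁱ (dual
-- q-Krawtchouk), or proportional to (2i + s*)(2i + 2 + s*) (Hahn).

open import Defs
open import Data.Nat.Base using (ℕ; suc; _≤_)
open import Data.Sum.Base using (_⊎_)

open import Algebra.Bundles using (CommutativeMonoid; CommutativeRing)
open import Algebra.Module.Bundles using (LeftModule)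
import Algebra.Module.Properties.LeftModule
import Algebra.Properties.AbelianGroup
import Algebra.Properties.CommutativeMonoid.Sum
import Algebra.Properties.CommutativeSemigroup
import Algebra.Properties.Ring
import Algebra.Properties.Semiring.Exp
import Algebra.Properties.Semiring.Mult.TCOptimised
import Algebra.Solver.Ring
open import Algebra.Solver.Ring.AlmostCommutativeRing
  using (fromCommutativeRing; _-Raw-AlmostCommutative⟶_)
open import Data.Fin.Base using (Fin; zero; suc; toℕ; inject; inject₁; fromℕ)
open import Data.Fin.Induction using (<-weakInduction)
open import Data.Fin.Properties
  using (_≟_; punchInᵢ≢i; toℕ-inject; toℕ-inject₁; toℕ-fromℕ; toℕ<n; toℕ-injective)
open import Data.Fin.Relation.Unary.Top using (view; ‵fromℕ; ‵inject₁)
open import Data.Integer.Base as ℤ using (ℤ; +_; -[1+_]; _⊖_)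
import Data.Integer.Properties as ℤ
open import Data.Maybe.Base using (map)
open import Data.Nat.Base as ℕ using (zero; ∣_-_∣; _<_)
import Data.Nat.Properties as ℕ
open import Data.Product.Base using (∃; ∃₂; _×_; _,_; proj₁; proj₂)
open import Data.Sum.Base using (inj₁; inj₂)
open import Data.Vec.Functional as Vector using (Vector; removeAt)
open import Function.Base using (_∘_)
open import Function.Bundles using (Equivalence)
open import Relation.Binary.Definitions using (tri<; tri≈; tri>)
open import Relation.Binary.PropositionalEquality.Core as ≡ using (_≡_; _≢_)
import Relation.Binary.Reasoning.Setoid
open import Relation.Nullary using (¬_; yes; no; contradiction)
open import Relation.Nullary.Decidable using (dec⇒maybe)

-- The formula for aᵢ comes from computing one number twice: the coefficient of the i-th eigenvector
-- of A* in uᵢ₊₁. From uᵢ₊₁ = (A - θᵢ) uᵢ it involves aᵢ and only the two top coefficients of uᵢ,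
-- because A is tridiagonal. From the split relation for A* uᵢ₊₁, or from u_{d+1} = 0 when i = d, it
-- is a multiple of the top coefficient of uᵢ. That top coefficient is a product of subdiagonal
-- entries of A, hence nonzero and cancellable.
--
-- The obstacle is the two ends. The closed formulas for the gaps of θ* extend to the indices 0 and
-- d + 1, but may vanish there. So no quotient is formed: each term of aᵢ is carried as a solution x
-- of x * Δ = f with f zero at both ends, and the equation for the diagonal of X is verified after
-- multiplying by x₂ + x₃ θ*ᵢ.
--
-- Zero diagonal alone would allow X = 0. That is excluded by the entry of X in position (0, 1),
-- which is x₂ + x₃ θ*₁ times a superdiagonal entry of A.

-- Integer coefficients let the solver cancel although equality in R need not be
-- decidable.

module IntegerCoefficients {c ℓ} (R : CommutativeRing c ℓ) where
  open CommutativeRing R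
  open Algebra.Properties.AbelianGroup +-abelianGroup using (⁻¹-∙-comm; ε⁻¹≈ε)
  open Algebra.Properties.Ring ring using (-‿distribˡ-*; -‿distribʳ-*; -‿involutive)
  open Algebra.Properties.Semiring.Mult.TCOptimised semiring using (×-homo-+; ×1-homo-*)
    renaming (_×_ to _×ⁿ_)
  open Algebra.Properties.CommutativeSemigroup +-commutativeSemigroup using (interchange)
  open Relation.Binary.Reasoning.Setoid setoid

  private
    infix 8 _#
    -- This multiple sends 1 to `1#` itself and not to `1# + 0#`, so `1-homo` is `refl` and the
    -- solver constant `con (+ 1)` unfolds to `1#`.
    _# : ℕ → Carrier
    n # = n ×ⁿ 1#

    ⟦_⟧ : ℤ → Carrier
    ⟦ + n ⟧     = n #
    ⟦ -[1+ n ] ⟧ = - (suc n #)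

    cong : ∀ {m n} → m ≡ n → ⟦ m ⟧ ≈ ⟦ n ⟧
    cong ≡.refl = refl

    ⊖-homo : ∀ m n → ⟦ m ⊖ n ⟧ ≈ m # - n #
    ⊖-homo m zero = sym (trans (+-congˡ ε⁻¹≈ε) (+-identityʳ _))
    ⊖-homo zero (suc n) = sym (+-identityˡ _)
    ⊖-homo (suc m) (suc n) = begin
      ⟦ suc m ⊖ suc n ⟧          ≈⟨ cong (ℤ.[1+m]⊖[1+n]≡m⊖n m n) ⟩
      ⟦ m ⊖ n ⟧                  ≈⟨ ⊖-homo m n ⟩
      m # - n #                  ≈⟨ +-identityˡ _ ⟨
      0# + (m # - n #)           ≈⟨ +-congʳ (-‿inverseʳ 1#) ⟨
      (1# - 1#) + (m # - n #)    ≈⟨ interchange _ _ _ _ ⟩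
      (1# + m #) + (- 1# - n #)  ≈⟨ +-cong (×-homo-+ 1# 1 m) (trans (-‿cong (×-homo-+ 1# 1 n)) (sym (⁻¹-∙-comm _ _))) ⟨
      suc m # - suc n #          ∎

    neg-homo : ∀ n → ⟦ ℤ.- n ⟧ ≈ - ⟦ n ⟧
    neg-homo (+ zero)  = sym ε⁻¹≈ε
    neg-homo (+ suc n) = refl
    neg-homo -[1+ n ]  = sym (-‿involutive _)

    +-homo : ∀ m n → ⟦ m ℤ.+ n ⟧ ≈ ⟦ m ⟧ + ⟦ n ⟧
    +-homo (+ m)    (+ n)    = ×-homo-+ 1# m n
    +-homo (+ m)    -[1+ n ] = ⊖-homo m (suc n)
    +-homo -[1+ m ] (+ n)    = trans (⊖-homo n (suc m)) (+-comm _ _)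
    +-homo -[1+ m ] -[1+ n ] = begin
      - (suc (suc (m ℕ.+ n)) #)  ≡⟨ ≡.cong (λ k → - (suc k #)) (≡.sym (ℕ.+-suc m n)) ⟩
      - ((suc m ℕ.+ suc n) #)    ≈⟨ -‿cong (×-homo-+ 1# (suc m) (suc n)) ⟩
      - (suc m # + suc n #)      ≈⟨ ⁻¹-∙-comm _ _ ⟨
      - (suc m #) - suc n #      ∎

    *-homo⁺ : ∀ m n → ⟦ + m ℤ.* n ⟧ ≈ m # * ⟦ n ⟧
    *-homo⁺ m (+ n) = trans (cong (≡.sym (ℤ.pos-* m n))) (×1-homo-* m n)
    *-homo⁺ m -[1+ n ] = begin
      ⟦ + m ℤ.* -[1+ n ] ⟧    ≈⟨ cong (ℤ.neg-distribʳ-* (+ m) (+ suc n)) ⟨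
      ⟦ ℤ.- (+ m ℤ.* + suc n) ⟧  ≈⟨ neg-homo (+ m ℤ.* + suc n) ⟩
      - ⟦ + m ℤ.* + suc n ⟧   ≈⟨ -‿cong (*-homo⁺ m (+ suc n)) ⟩
      - (m # * suc n #)       ≈⟨ -‿distribʳ-* _ _ ⟩
      m # * - (suc n #)       ∎

    *-homo : ∀ m n → ⟦ m ℤ.* n ⟧ ≈ ⟦ m ⟧ * ⟦ n ⟧
    *-homo (+ m)    n = *-homo⁺ m n
    *-homo -[1+ m ] n = begin
      ⟦ -[1+ m ] ℤ.* n ⟧      ≈⟨ cong (ℤ.neg-distribˡ-* (+ suc m) n) ⟨
      ⟦ ℤ.- (+ suc m ℤ.* n) ⟧ ≈⟨ neg-homo (+ suc m ℤ.* n) ⟩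
      - ⟦ + suc m ℤ.* n ⟧     ≈⟨ -‿cong (*-homo⁺ (suc m) n) ⟩
      - (suc m # * ⟦ n ⟧)     ≈⟨ -‿distribˡ-* _ _ ⟩
      - (suc m #) * ⟦ n ⟧     ∎

    morphism : ℤ.+-*-rawRing -Raw-AlmostCommutative⟶ fromCommutativeRing R
    morphism = record
      { ⟦_⟧ = ⟦_⟧ ; +-homo = +-homo ; *-homo = *-homo ; -‿homo = neg-homo
      ; 0-homo = refl ; 1-homo = refl }

  open Algebra.Solver.Ring ℤ.+-*-rawRing (fromCommutativeRing R) morphism
    (λ m n → map cong (dec⇒maybe (m ℤ.≟ n))) public

-- Finite sums with one or two nonzero terms.

module FiniteSums {c ℓ} (M : CommutativeMonoid c ℓ) where
  open CommutativeMonoid M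
    renaming (ε to 0#; _∙_ to _+_; ∙-congˡ to +-congˡ; ∙-congʳ to +-congʳ;
              identityˡ to +-identityˡ; identityʳ to +-identityʳ)
  open Algebra.Properties.CommutativeMonoid.Sum M
  open Relation.Binary.Reasoning.Setoid setoid

  sum-zero : ∀ {n} (f : Vector Carrier n) → (∀ i → f i ≈ 0#) → sum f ≈ 0#
  sum-zero {n} f f≈0 = trans (sum-cong-≋ f≈0) (sum-replicate-zero n)

  sum-single : ∀ {n} (f : Vector Carrier n) i → (∀ j → j ≢ i → f j ≈ 0#) →
               sum f ≈ f i
  sum-single {suc n} f i others = begin
    sum f                       ≈⟨ sum-remove {i = i} f ⟩
    f i + sum (removeAt f i)    ≈⟨ +-congˡ (sum-zero (removeAt f i) λ j → others _ (punchInᵢ≢i i j)) ⟩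
    f i + 0#                    ≈⟨ +-identityʳ _ ⟩
    f i                         ∎

  private
    -- Zeroing the i-th term instead of deleting it keeps the index set, so in `sum-pair` the lemma
    -- `sum-single` applies at `k` without renumbering.
    without : ∀ {n} → Fin n → Vector Carrier n → Vector Carrier n
    without i f j with j ≟ i
    ... | yes _ = 0#
    ... | no  _ = f j

    without-self : ∀ {n} i (f : Vector Carrier n) → without i f i ≈ 0#
    without-self i f with i ≟ i
    ... | yes _  = refl
    ... | no i≢i = contradiction ≡.refl i≢i

    without-other : ∀ {n} i (f : Vector Carrier n) j → j ≢ i → without i f j ≈ f j
    without-other i f j j≢i with j ≟ i
    ... | yes j≡i = contradiction j≡i j≢i
    ... | no  _   = refl

  sum-pair : ∀ {n} (f : Vector Carrier n) i k → i ≢ k →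
             (∀ j → j ≢ i → j ≢ k → f j ≈ 0#) → sum f ≈ f i + f k
  sum-pair {suc n} f i k i≢k others = begin
    sum f                                  ≈⟨ sum-remove {i = i} f ⟩
    f i + sum (removeAt f i)               ≈⟨ +-congˡ (sum-cong-≋ λ j → without-other i f _ (punchInᵢ≢i i j)) ⟨
    f i + sum (removeAt f′ i)              ≈⟨ +-congˡ (trans (+-congʳ (without-self i f)) (+-identityˡ _)) ⟨
    f i + (f′ i + sum (removeAt f′ i))     ≈⟨ +-congˡ (sum-remove {i = i} f′) ⟨
    f i + sum f′                           ≈⟨ +-congˡ (sum-single f′ k vanish) ⟩
    f i + f′ k                             ≈⟨ +-congˡ (without-other i f k (i≢k ∘ ≡.sym)) ⟩
    f i + f k                              ∎
    where
    f′ = without i f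
    vanish : ∀ j → j ≢ k → f′ j ≈ 0#
    vanish j j≢k with j ≟ i
    ... | yes _  = refl
    ... | no j≢i = others j j≢i j≢k

-- Cancellation and division in a field.

module FieldProperties {c ℓ} (F : Field c ℓ) where
  open Field F
  open Relation.Binary.Reasoning.Setoid setoid

  *-cancelˡ-≉0 : ∀ {x y z} → x ≉ 0# → x * y ≈ x * z → y ≈ z
  *-cancelˡ-≉0 {x} {y} {z} x≉0 xy≈xz with inverse x x≉0
  ... | x⁻¹ , x⁻¹x≈1 , _ = begin
    y              ≈⟨ *-identityˡ y ⟨
    1# * y         ≈⟨ *-congʳ x⁻¹x≈1 ⟨
    x⁻¹ * x * y    ≈⟨ *-assoc _ _ _ ⟩
    x⁻¹ * (x * y)  ≈⟨ *-congˡ xy≈xz ⟩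
    x⁻¹ * (x * z)  ≈⟨ *-assoc _ _ _ ⟨
    x⁻¹ * x * z    ≈⟨ *-congʳ x⁻¹x≈1 ⟩
    1# * z         ≈⟨ *-identityˡ z ⟩
    z              ∎

  divide : ∀ {x} y → x ≉ 0# → ∃ λ z → x * z ≈ y
  divide {x} y x≉0 with inverse x x≉0
  ... | x⁻¹ , _ , xx⁻¹≈1 = x⁻¹ * y ,
    trans (sym (*-assoc _ _ _)) (trans (*-congʳ xx⁻¹≈1) (*-identityˡ y))

  *-≉0 : ∀ {x y} → x ≉ 0# → y ≉ 0# → x * y ≉ 0#
  *-≉0 x≉0 y≉0 xy≈0 = y≉0 (*-cancelˡ-≉0 x≉0 (trans xy≈0 (sym (zeroʳ _))))

-- Coordinates with respect to a basis.

module Coordinates {c ℓ m ℓm} (F : Field c ℓ) (V : VectorSpace F m ℓm) where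
  open Field F hiding (zero)
  open FieldNotions F using (Matrix)
  open LeftModule V
  open LinearAlgebra F V
  open Algebra.Module.Properties.LeftModule V using (inverseˡ-uniqueᴹ)
  open Algebra.Properties.Ring ring using (-1*x≈-x)
  private
    module Σ  = Algebra.Properties.CommutativeMonoid.Sum +-commutativeMonoid
    module Σᴹ = Algebra.Properties.CommutativeMonoid.Sum +ᴹ-commutativeMonoid
    module ⊕  = FiniteSums +-commutativeMonoid
    module ⊕ᴹ = FiniteSums +ᴹ-commutativeMonoid
  open Σ using (sum)
  module ≈-R  = Relation.Binary.Reasoning.Setoid setoid
  module ≈ᴹ-R = Relation.Binary.Reasoning.Setoid ≈ᴹ-setoid

  -1*ₗv≈-v : ∀ v → - 1# *ₗ v ≈ᴹ -ᴹ v
  -1*ₗv≈-v v = inverseˡ-uniqueᴹ _ _ (begin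
    - 1# *ₗ v +ᴹ v        ≈⟨ +ᴹ-congˡ (*ₗ-identityˡ v) ⟨
    - 1# *ₗ v +ᴹ 1# *ₗ v  ≈⟨ *ₗ-distribʳ v (- 1#) 1# ⟨
    (- 1# + 1#) *ₗ v      ≈⟨ *ₗ-cong (-‿inverseˡ 1#) ≈ᴹ-refl ⟩
    0# *ₗ v               ≈⟨ *ₗ-zeroˡ v ⟩
    0ᴹ                    ∎)
    where
    open ≈ᴹ-R

  lc-cong : ∀ {n} {a a′ : Vector Carrier n} (b : Vector Carrierᴹ n) →
            (∀ i → a i ≈ a′ i) → linearCombination a b ≈ᴹ linearCombination a′ b
  lc-cong b a≈a′ = Σᴹ.sum-cong-≋ λ i → *ₗ-cong (a≈a′ i) ≈ᴹ-refl

  lc-+ : ∀ {n} (a a′ : Vector Carrier n) b →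
         linearCombination a b +ᴹ linearCombination a′ b ≈ᴹ
         linearCombination (λ i → a i + a′ i) b
  lc-+ a a′ b = ≈ᴹ-trans (≈ᴹ-sym (Σᴹ.∑-distrib-+ (λ i → a i *ₗ b i) (λ i → a′ i *ₗ b i)))
    (Σᴹ.sum-cong-≋ λ i → ≈ᴹ-sym (*ₗ-distribʳ (b i) (a i) (a′ i)))

  *ₗ-sumᴹ : ∀ {n} x (f : Vector Carrierᴹ n) → x *ₗ sumᴹ f ≈ᴹ sumᴹ (λ i → x *ₗ f i)
  *ₗ-sumᴹ {zero}  x f = *ₗ-zeroʳ x
  *ₗ-sumᴹ {suc n} x f = ≈ᴹ-trans (*ₗ-distribˡ x _ _) (+ᴹ-congˡ (*ₗ-sumᴹ x (f ∘ suc)))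

  lc-*ₗ : ∀ {n} x (a : Vector Carrier n) b →
         x *ₗ linearCombination a b ≈ᴹ linearCombination (λ i → x * a i) b
  lc-*ₗ x a b = ≈ᴹ-trans (*ₗ-sumᴹ x λ i → a i *ₗ b i)
    (Σᴹ.sum-cong-≋ λ i → ≈ᴹ-sym (*ₗ-assoc x (a i) (b i)))

  $-sumᴹ : ∀ {n} (X : End) (f : Vector Carrierᴹ n) → X $ sumᴹ f ≈ᴹ sumᴹ (λ i → X $ f i)
  $-sumᴹ {zero}  X f = End.0ᴹ-homo X
  $-sumᴹ {suc n} X f = ≈ᴹ-trans (End.+ᴹ-homo X _ _) (+ᴹ-congˡ ($-sumᴹ X (f ∘ suc)))

  $-lc : ∀ {n} (X : End) (a : Vector Carrier n) b →
         X $ linearCombination a b ≈ᴹ linearCombination a (λ i → X $ b i)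
  $-lc X a b = ≈ᴹ-trans ($-sumᴹ X λ i → a i *ₗ b i) (Σᴹ.sum-cong-≋ λ i → End.*ₗ-homo X (a i) (b i))

  δ : ∀ {n} → Fin n → Fin n → Carrier
  δ i j with i ≟ j
  ... | yes _ = 1#
  ... | no  _ = 0#

  δ-refl : ∀ {n} (i : Fin n) → δ i i ≈ 1#
  δ-refl i with i ≟ i
  ... | yes _  = refl
  ... | no i≢i = contradiction ≡.refl i≢i

  δ-≢ : ∀ {n} {i j : Fin n} → i ≢ j → δ i j ≈ 0#
  δ-≢ {i = i} {j} i≢j with i ≟ j
  ... | yes i≡j = contradiction i≡j i≢j
  ... | no _    = refl

  module _ {n} {b : Vector Carrierᴹ n} (isBasis : IsBasis b) where
    open IsBasis isBasis

    coord : Carrierᴹ → Vector Carrier n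
    coord v = proj₁ (spanning v)

    expansion : ∀ v → v ≈ᴹ linearCombination (coord v) b
    expansion v = proj₂ (spanning v)

    -- The witness of `spanning` is an arbitrary choice that need not respect `≈ᴹ`; independence
    -- makes it canonical. Congruence and linearity of `coord` are instances of this.
    coord-unique : ∀ {v} a → v ≈ᴹ linearCombination a b → ∀ i → coord v i ≈ a i
    coord-unique {v} a v≈ab i = begin
      coord v i                              ≈⟨ +-identityʳ _ ⟨
      coord v i + 0#                         ≈⟨ +-congˡ (trans (+-congʳ (-1*x≈-x (a i))) (-‿inverseˡ (a i))) ⟨
      coord v i + (- 1# * a i + a i)         ≈⟨ +-assoc _ _ _ ⟨
      (coord v i + - 1# * a i) + a i         ≈⟨ +-congʳ (independent (λ j → coord v j + - 1# * a j) difference≈0 i) ⟩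
      0# + a i                               ≈⟨ +-identityˡ _ ⟩
      a i                                    ∎
      where
      open ≈-R
      difference≈0 : linearCombination (λ j → coord v j + - 1# * a j) b ≈ᴹ 0ᴹ
      difference≈0 = ≈ᴹ-R.begin
        linearCombination (λ j → coord v j + - 1# * a j) b
          ≈ᴹ-R.≈⟨ lc-+ (coord v) (λ j → - 1# * a j) b ⟨
        linearCombination (coord v) b +ᴹ linearCombination (λ j → - 1# * a j) b
          ≈ᴹ-R.≈⟨ +ᴹ-cong (expansion v) (lc-*ₗ (- 1#) a b) ⟨
        v +ᴹ - 1# *ₗ linearCombination a b
          ≈ᴹ-R.≈⟨ +ᴹ-congˡ (*ₗ-cong refl v≈ab) ⟨
        v +ᴹ - 1# *ₗ v
          ≈ᴹ-R.≈⟨ +ᴹ-congˡ (-1*ₗv≈-v v) ⟩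
        v +ᴹ -ᴹ v
          ≈ᴹ-R.≈⟨ -ᴹ‿inverseʳ v ⟩
        0ᴹ ≈ᴹ-R.∎

    coord-injective : ∀ {v w} → (∀ i → coord v i ≈ coord w i) → v ≈ᴹ w
    coord-injective {v} {w} v~w =
      ≈ᴹ-trans (expansion v) (≈ᴹ-trans (lc-cong b v~w) (≈ᴹ-sym (expansion w)))

    coord-cong : ∀ {v w} → v ≈ᴹ w → ∀ i → coord v i ≈ coord w i
    coord-cong {v} {w} v≈w = coord-unique (coord w) (≈ᴹ-trans v≈w (expansion w))

    coord-+ : ∀ v w i → coord (v +ᴹ w) i ≈ coord v i + coord w i
    coord-+ v w = coord-unique _
      (≈ᴹ-trans (+ᴹ-cong (expansion v) (expansion w)) (lc-+ (coord v) (coord w) b))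

    coord-*ₗ : ∀ x v i → coord (x *ₗ v) i ≈ x * coord v i
    coord-*ₗ x v = coord-unique _ (≈ᴹ-trans (*ₗ-cong refl (expansion v)) (lc-*ₗ x (coord v) b))

    coord-0 : ∀ i → coord 0ᴹ i ≈ 0#
    coord-0 i = trans (coord-cong (≈ᴹ-sym (*ₗ-zeroˡ 0ᴹ)) i) (trans (coord-*ₗ 0# 0ᴹ i) (zeroˡ _))

    coord-−*ₗ : ∀ v x w i → coord (v -ᴹ x *ₗ w) i ≈ coord v i - x * coord w i
    coord-−*ₗ v x w i = begin
      coord (v -ᴹ x *ₗ w) i               ≈⟨ coord-+ v _ i ⟩
      coord v i + coord (-ᴹ (x *ₗ w)) i   ≈⟨ +-congˡ (coord-cong (≈ᴹ-sym (-1*ₗv≈-v _)) i) ⟩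
      coord v i + coord (- 1# *ₗ x *ₗ w) i  ≈⟨ +-congˡ (coord-*ₗ (- 1#) _ i) ⟩
      coord v i + - 1# * coord (x *ₗ w) i ≈⟨ +-congˡ (-1*x≈-x _) ⟩
      coord v i - coord (x *ₗ w) i        ≈⟨ +-congˡ (-‿cong (coord-*ₗ x w i)) ⟩
      coord v i - x * coord w i           ∎
      where
      open ≈-R

    coord-sumᴹ : ∀ {k} (f : Vector Carrierᴹ k) i → coord (sumᴹ f) i ≈ sum (λ j → coord (f j) i)
    coord-sumᴹ {zero}  f i = coord-0 i
    coord-sumᴹ {suc k} f i = trans (coord-+ _ _ i) (+-congˡ (coord-sumᴹ (f ∘ suc) i))

    coord-lc : ∀ {k} (a : Vector Carrier k) (w : Vector Carrierᴹ k) i →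
               coord (linearCombination a w) i ≈ sum (λ j → a j * coord (w j) i)
    coord-lc a w i = trans (coord-sumᴹ (λ j → a j *ₗ w j) i)
      (Σ.sum-cong-≋ λ j → coord-*ₗ (a j) (w j) i)

    coord-basis : ∀ j i → coord (b j) i ≈ δ j i
    coord-basis j = coord-unique (δ j) (≈ᴹ-sym (begin
      linearCombination (δ j) b  ≈⟨ ⊕ᴹ.sum-single _ j (λ i i≢j →
                                      ≈ᴹ-trans (*ₗ-cong (δ-≢ (i≢j ∘ ≡.sym)) ≈ᴹ-refl) (*ₗ-zeroˡ (b i))) ⟩
      δ j j *ₗ b j               ≈⟨ *ₗ-cong (δ-refl j) ≈ᴹ-refl ⟩
      1# *ₗ b j                  ≈⟨ *ₗ-identityˡ (b j) ⟩
      b j                        ∎))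
      where
      open ≈ᴹ-R

    coord-matrix : ∀ {X : End} {M : Matrix n} → IsMatrixOf b X M →
                   ∀ v i → coord (X $ v) i ≈ sum (λ j → coord v j * M i j)
    coord-matrix {X} {M} isMatrix v i = begin
      coord (X $ v) i
        ≈⟨ coord-cong (≈ᴹ-trans (End.⟦⟧-cong X (expansion v)) ($-lc X (coord v) b)) i ⟩
      coord (linearCombination (coord v) (λ j → X $ b j)) i
        ≈⟨ coord-lc (coord v) (λ j → X $ b j) i ⟩
      sum (λ j → coord v j * coord (X $ b j) i)
        ≈⟨ Σ.sum-cong-≋ (λ j → *-congˡ (coord-unique (λ i → M i j) (isMatrix j) i)) ⟩
      sum (λ j → coord v j * M i j) ∎
      where
      open ≈-R

    coord-eigenbasis : ∀ {X : End} {θ : Vector Carrier n} → (∀ j → Eigenspace X (θ j) (b j)) →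
                       ∀ v i → coord (X $ v) i ≈ θ i * coord v i
    coord-eigenbasis {X} {θ} eigen v i = begin
      coord (X $ v) i
        ≈⟨ coord-cong (≈ᴹ-trans (End.⟦⟧-cong X (expansion v)) ($-lc X (coord v) b)) i ⟩
      coord (linearCombination (coord v) (λ j → X $ b j)) i
        ≈⟨ coord-unique (λ j → θ j * coord v j) (Σᴹ.sum-cong-≋ λ j →
             ≈ᴹ-trans (*ₗ-cong refl (eigen j))
               (≈ᴹ-trans (≈ᴹ-sym (*ₗ-assoc _ _ _)) (*ₗ-cong (*-comm _ _) ≈ᴹ-refl))) i ⟩
      θ i * coord v i ∎
      where
      open ≈-R

-- Newton polynomials and split vectors.

-- Indexing by ℕ lets the recurrences reach u_{d+1} without casts between `Fin` types. The vectors
-- up to `split u (suc d)` never read the default value.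
padded : ∀ {a} {A : Set a} {n} → A → Vector A n → ℕ → A
padded {n = zero}  x f k       = x
padded {n = suc n} x f zero    = f zero
padded {n = suc n} x f (suc k) = padded x (f ∘ suc) k

padded-toℕ : ∀ {a} {A : Set a} {n} (x : A) (f : Vector A n) i → padded x f (toℕ i) ≡ f i
padded-toℕ x f zero    = ≡.refl
padded-toℕ x f (suc i) = padded-toℕ x (f ∘ suc) i

module NewtonPolynomials {c ℓ} (F : Field c ℓ) where
  open Field F hiding (zero)
  open IntegerCoefficients commutativeRing using (solve; _:=_; _:*_; _:-_)
  open Relation.Binary.Reasoning.Setoid setoid

  newton : (ℕ → Carrier) → ℕ → Carrier → Carrier
  newton t zero    x = 1#
  newton t (suc n) x = (x - t 0) * newton (t ∘ suc) n x

  -- The definition peels off the first factor, as `splitVector` does; this peels off the last one,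
  -- as `split` does.
  newton-suc : ∀ t n x → newton t (suc n) x ≈ (x - t n) * newton t n x
  newton-suc t zero    x = refl
  newton-suc t (suc n) x = begin
    (x - t 0) * newton (t ∘ suc) (suc n) x               ≈⟨ *-congˡ (newton-suc (t ∘ suc) n x) ⟩
    (x - t 0) * ((x - t (suc n)) * newton (t ∘ suc) n x) ≈⟨ solve 3 (λ a b c → a :* (b :* c) := b :* (a :* c)) refl _ _ _ ⟩
    (x - t (suc n)) * newton t (suc n) x                 ∎

  newton-root : ∀ t k n → k < n → newton t n (t k) ≈ 0#
  newton-root t zero    (suc n) _  = trans (*-congʳ (-‿inverseʳ _)) (zeroˡ _)
  newton-root t (suc k) (suc n) k<n =
    trans (*-congˡ (newton-root (t ∘ suc) k n (ℕ.s<s⁻¹ k<n))) (zeroʳ _)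

module SplitVectors {c ℓ m ℓm} (F : Field c ℓ) (V : VectorSpace F m ℓm) (d : ℕ)
  (A : LinearAlgebra.End F V) (θ : Vector (Field.Carrier F) (suc d))
  {b : Vector (LeftModule.Carrierᴹ V) (suc d)} (isBasis : LinearAlgebra.IsBasis F V b)
  (eigen : ∀ j → LinearAlgebra.Eigenspace F V A (θ j) (b j)) where
  open Field F hiding (zero)
  open LeftModule V
  open LinearAlgebra F V
  open Coordinates F V
  open Leonard F V using (splitVector)
  open NewtonPolynomials F
  open IntegerCoefficients commutativeRing using (solve; _:=_; _:*_; _:-_)
  open ≈-R

  t : ℕ → Carrier
  t = padded 0# θ

  shift : Carrier → Carrierᴹ → Carrierᴹ
  shift x v = A $ v -ᴹ x *ₗ v

  -- Here the newest factor is outermost, so consecutive vectors are related by one application of A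
  -- - θₙ. In `splitVector` the factor of θ₀ is outermost.
  split : Carrierᴹ → ℕ → Carrierᴹ
  split u zero    = u
  split u (suc n) = shift (t n) (split u n)

  private
    κ : Carrierᴹ → Vector Carrier (suc d)
    κ = coord isBasis

    coord-shift : ∀ x v i → κ (shift x v) i ≈ (θ i - x) * κ v i
    coord-shift x v i = begin
      κ (A $ v -ᴹ x *ₗ v) i    ≈⟨ coord-−*ₗ isBasis _ x v i ⟩
      κ (A $ v) i - x * κ v i  ≈⟨ +-congʳ (coord-eigenbasis isBasis {A} {θ} eigen v i) ⟩
      θ i * κ v i - x * κ v i  ≈⟨ solve 3 (λ a b c → a :* b :- c :* b := (a :- c) :* b) refl _ _ _ ⟩
      (θ i - x) * κ v i        ∎

    coord-split : ∀ u n i → κ (split u n) i ≈ newton t n (θ i) * κ u i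
    coord-split u zero    i = sym (*-identityˡ _)
    coord-split u (suc n) i = begin
      κ (shift (t n) (split u n)) i                 ≈⟨ coord-shift (t n) _ i ⟩
      (θ i - t n) * κ (split u n) i                 ≈⟨ *-congˡ (coord-split u n i) ⟩
      (θ i - t n) * (newton t n (θ i) * κ u i)      ≈⟨ *-assoc _ _ _ ⟨
      (θ i - t n) * newton t n (θ i) * κ u i        ≈⟨ *-congʳ (newton-suc t n (θ i)) ⟨
      newton t (suc n) (θ i) * κ u i                ∎

    coord-foldr : ∀ {n} (f : Vector Carrier n) s → (∀ k → f k ≡ s (toℕ k)) → ∀ u i →
                  κ (Vector.foldr shift u f) i ≈ newton s n (θ i) * κ u i
    coord-foldr {zero}  f s f≡s u i = sym (*-identityˡ _)
    coord-foldr {suc n} f s f≡s u i = begin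
      κ (shift (f zero) (Vector.foldr shift u (f ∘ suc))) i   ≈⟨ coord-shift (f zero) _ i ⟩
      (θ i - f zero) * κ (Vector.foldr shift u (f ∘ suc)) i   ≈⟨ *-cong (+-congˡ (-‿cong (reflexive (f≡s zero))))
                                                                        (coord-foldr (f ∘ suc) (s ∘ suc) (f≡s ∘ suc) u i) ⟩
      (θ i - s 0) * (newton (s ∘ suc) n (θ i) * κ u i)        ≈⟨ *-assoc _ _ _ ⟨
      newton s (suc n) (θ i) * κ u i                          ∎

  t-toℕ : ∀ i → t (toℕ i) ≡ θ i
  t-toℕ = padded-toℕ 0# θ

  -- Both sides apply the same commuting factors, in opposite orders. In the eigenbasis of A each
  -- factor is a scalar on every coordinate, and both sides become `newton` times the coordinate of
  -- `u`.
  splitVector≈split : ∀ u i → splitVector A θ u i ≈ᴹ split u (toℕ i)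
  splitVector≈split u i = coord-injective isBasis λ j →
    trans (coord-foldr (λ k → θ (inject {i = i} k)) t
             (λ k → ≡.trans (≡.sym (t-toℕ (inject {i = i} k))) (≡.cong t (toℕ-inject k))) u j)
      (sym (coord-split u (toℕ i) j))

  -- Cayley–Hamilton for the diagonalisable A.
  split-end : ∀ u → split u (suc d) ≈ᴹ 0ᴹ
  split-end u = coord-injective isBasis λ i → begin
    κ (split u (suc d)) i                   ≈⟨ coord-split u (suc d) i ⟩
    newton t (suc d) (θ i) * κ u i          ≡⟨ ≡.cong (λ x → newton t (suc d) x * κ u i) (≡.sym (t-toℕ i)) ⟩
    newton t (suc d) (t (toℕ i)) * κ u i    ≈⟨ *-congʳ (newton-root t (toℕ i) (suc d) (toℕ<n i)) ⟩
    0# * κ u i                              ≈⟨ zeroˡ _ ⟩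
    0#                                      ≈⟨ coord-0 isBasis i ⟨
    κ 0ᴹ i                                  ∎

-- The matrix of A in the eigenbasis of A*, and the entries of X.

module LeonardSystemProperties {c ℓ m ℓm} (F : Field c ℓ) (V : VectorSpace F m ℓm) {d : ℕ}
  (Φ : Leonard.LeonardSystem F V d) where
  open Leonard F V
  open Field F hiding (zero)
  open FieldNotions F
  open FieldProperties F
  open LeftModule V
  open LeonardSystem Φ
  open Coordinates F V
  open Algebra.Properties.Ring ring using (-‿distribʳ-*; -‿involutive; -0#≈0#)
  open IntegerCoefficients commutativeRing using (solve; _:=_; _:*_; _:-_; _:+_; :-_)
  private
    module Σ  = Algebra.Properties.CommutativeMonoid.Sum +-commutativeMonoid
    module ⊕  = FiniteSums +-commutativeMonoid
    module ⊕ᴹ = FiniteSums +ᴹ-commutativeMonoid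

    b* : Vector Carrierᴹ (suc d)
    b* = proj₁ (proj₂ isStandardOrdering*)

    b*-eigenvector : ∀ i → IsEigenvector A* (θ* i) (b* i)
    b*-eigenvector = proj₁ (proj₂ (proj₂ isStandardOrdering*))

    tridiagonalBasis : IsTridiagonalDiagonalBasis A A* b*
    tridiagonalBasis = proj₂ (proj₂ (proj₂ isStandardOrdering*))

    open IsTridiagonalDiagonalBasis tridiagonalBasis using (tridiagonalX)
      renaming (isBasis to b*-isBasis)

    θ*-distinct : ∀ {i j} → i ≢ j → θ* i ≉ θ* j
    θ*-distinct = IsEigenvalueOrdering.distinct (proj₁ isStandardOrdering*) _ _

    M : Matrix (suc d)
    M = proj₁ tridiagonalX

    M-isMatrix : IsMatrixOf b* A M
    M-isMatrix = proj₁ (proj₂ tridiagonalX)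

    open IsIrreducibleTridiagonal (proj₂ (proj₂ tridiagonalX))

    κ : Carrierᴹ → Vector Carrier (suc d)
    κ = coord b*-isBasis

    κ-A : ∀ v i → κ (A $ v) i ≈ Σ.sum (λ j → κ v j * M i j)
    κ-A = coord-matrix b*-isBasis {A} {M} M-isMatrix

    κ-A* : ∀ v i → κ (A* $ v) i ≈ θ* i * κ v i
    κ-A* = coord-eigenbasis b*-isBasis {A*} (proj₂ ∘ b*-eigenvector)

  a : Vector Carrier (suc d)
  a i = M i i

  private
    E*-b* : ∀ i j → E* i $ b* j ≈ᴹ δ j i *ₗ b* i
    E*-b* i j with j ≟ i
    ... | yes ≡.refl = ≈ᴹ-trans (fixes (b* i) (proj₂ (b*-eigenvector i))) (≈ᴹ-sym (*ₗ-identityˡ _))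
      where
      open IsProjection (proj₂ (isPrimitiveIdempotent* i))
    ... | no j≢i = ≈ᴹ-trans (Equivalence.from (kernel (b* j))
        (1 , (λ _ → θ* j) , (λ _ → b* j) , (λ _ → θ*-distinct j≢i , proj₂ (b*-eigenvector j)) ,
         ≈ᴹ-sym (+ᴹ-identityʳ _)))
        (≈ᴹ-sym (*ₗ-zeroˡ _))
      where
      open IsProjection (proj₂ (isPrimitiveIdempotent* i))

    -- Sandwiching an endomorphism between two copies of `E* i` therefore keeps only its (i, i)
    -- entry.
    E*-expansion : ∀ i v → E* i $ v ≈ᴹ κ v i *ₗ b* i
    E*-expansion i v = begin
      E* i $ v
        ≈⟨ End.⟦⟧-cong (E* i) (expansion b*-isBasis v) ⟩
      E* i $ linearCombination (κ v) b*
        ≈⟨ $-lc (E* i) (κ v) b* ⟩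
      linearCombination (κ v) (λ j → E* i $ b* j)
        ≈⟨ ⊕ᴹ.sum-single (λ j → κ v j *ₗ E* i $ b* j) i vanish ⟩
      κ v i *ₗ E* i $ b* i
        ≈⟨ *ₗ-cong refl (≈ᴹ-trans (E*-b* i i) (*ₗ-cong (δ-refl i) ≈ᴹ-refl)) ⟩
      κ v i *ₗ 1# *ₗ b* i
        ≈⟨ *ₗ-cong refl (*ₗ-identityˡ _) ⟩
      κ v i *ₗ b* i ∎
      where
      open ≈ᴹ-R
      vanish : ∀ j → j ≢ i → κ v j *ₗ E* i $ b* j ≈ᴹ 0ᴹ
      vanish j j≢i = begin
        κ v j *ₗ E* i $ b* j     ≈⟨ *ₗ-cong refl (E*-b* i j) ⟩
        κ v j *ₗ δ j i *ₗ b* i   ≈⟨ *ₗ-cong refl (*ₗ-cong (δ-≢ j≢i) ≈ᴹ-refl) ⟩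
        κ v j *ₗ 0# *ₗ b* i      ≈⟨ *ₗ-cong refl (*ₗ-zeroˡ _) ⟩
        κ v j *ₗ 0ᴹ              ≈⟨ *ₗ-zeroʳ _ ⟩
        0ᴹ                       ∎

  module _ (x₀ x₁ x₂ x₃ : Carrier) where

    private
      X : End
      X = x₀ ·ₑ idₑ +ₑ x₁ ·ₑ A* +ₑ x₂ ·ₑ A +ₑ x₃ ·ₑ (A ∘ₑ A*)

      -- In A A* the factor A* acts first, so the affine factor in front of `M i j` carries the
      -- eigenvalue of the column index j.
      entry : ∀ i j → κ (X $ b* j) i ≈ (x₀ + x₁ * θ* j) * δ j i + (x₂ + x₃ * θ* j) * M i j
      entry i j = begin
        κ (X $ b* j) i
          ≈⟨ trans (κ+ _ _ i) (+-congʳ (trans (κ+ _ _ i) (+-congʳ (κ+ _ _ i)))) ⟩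
        κ (x₀ *ₗ b* j) i + κ (x₁ *ₗ A* $ b* j) i + κ (x₂ *ₗ A $ b* j) i + κ (x₃ *ₗ A $ A* $ b* j) i
          ≈⟨ +-cong (+-cong (+-cong (κ* x₀ _ i) (κ* x₁ _ i)) (κ* x₂ _ i)) (κ* x₃ _ i) ⟩
        x₀ * κ (b* j) i + x₁ * κ (A* $ b* j) i + x₂ * κ (A $ b* j) i + x₃ * κ (A $ A* $ b* j) i
          ≈⟨ +-cong (+-cong (+-cong (*-congˡ bj) (*-congˡ A*bj)) (*-congˡ Abj)) (*-congˡ AA*bj) ⟩
        x₀ * δ j i + x₁ * (θ* j * δ j i) + x₂ * M i j + x₃ * (θ* j * M i j)
          ≈⟨ solve 7 (λ x₀ x₁ x₂ x₃ t δ M → x₀ :* δ :+ x₁ :* (t :* δ) :+ x₂ :* M :+ x₃ :* (t :* M)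
               := (x₀ :+ x₁ :* t) :* δ :+ (x₂ :+ x₃ :* t) :* M) refl x₀ x₁ x₂ x₃ (θ* j) (δ j i) (M i j) ⟩
        (x₀ + x₁ * θ* j) * δ j i + (x₂ + x₃ * θ* j) * M i j ∎
        where
        open ≈-R
        κ+ = coord-+ b*-isBasis
        κ* = coord-*ₗ b*-isBasis
        bj  = coord-basis b*-isBasis j i
        Abj = coord-unique b*-isBasis (λ i → M i j) (M-isMatrix j) i
        A*bj = trans (coord-cong b*-isBasis (proj₂ (b*-eigenvector j)) i)
          (trans (κ* (θ* j) _ i) (*-congˡ bj))
        AA*bj = trans (coord-cong b*-isBasis
            (≈ᴹ-trans (End.⟦⟧-cong A (proj₂ (b*-eigenvector j))) (End.*ₗ-homo A _ _)) i)
          (trans (κ* (θ* j) _ i) (*-congˡ Abj))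

    zeroDiagonalSpace : (∀ i → (x₀ + x₁ * θ* i) + (x₂ + x₃ * θ* i) * a i ≈ 0#) →
                        ZeroDiagonalSpace Φ X
    zeroDiagonalSpace diagonal = (x₀ , x₁ , x₂ , x₃ , λ v → ≈ᴹ-refl) , λ i v → begin
      E* i $ X $ E* i $ v            ≈⟨ E*-expansion i _ ⟩
      κ (X $ E* i $ v) i *ₗ b* i     ≈⟨ *ₗ-cong (coefficient i v) ≈ᴹ-refl ⟩
      0# *ₗ b* i                     ≈⟨ *ₗ-zeroˡ _ ⟩
      0ᴹ                             ∎
      where
      open ≈ᴹ-R
      coefficient : ∀ i v → κ (X $ E* i $ v) i ≈ 0#
      coefficient i v = ≈-R.begin
        κ (X $ E* i $ v) i
          ≈-R.≈⟨ coord-cong b*-isBasis (≈ᴹ-trans (End.⟦⟧-cong X (E*-expansion i v)) (End.*ₗ-homo X _ _)) i ⟩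
        κ (κ v i *ₗ X $ b* i) i
          ≈-R.≈⟨ coord-*ₗ b*-isBasis _ _ i ⟩
        κ v i * κ (X $ b* i) i
          ≈-R.≈⟨ *-congˡ (entry i i) ⟩
        κ v i * ((x₀ + x₁ * θ* i) * δ i i + (x₂ + x₃ * θ* i) * M i i)
          ≈-R.≈⟨ *-congˡ (+-congʳ (trans (*-congˡ (δ-refl i)) (*-identityʳ _))) ⟩
        κ v i * ((x₀ + x₁ * θ* i) + (x₂ + x₃ * θ* i) * a i)
          ≈-R.≈⟨ trans (*-congˡ (diagonal i)) (zeroʳ _) ⟩
        0# ≈-R.∎

    -- Off the diagonal only the multiple of `M i j` survives, and `M i j` is nonzero for
    -- neighbouring indices by irreducibility.
    nonzero : ∀ i j → ∣ toℕ i - toℕ j ∣ ≡ 1 → x₂ + x₃ * θ* j ≉ 0# → ¬ (X ≈ₑ 0ₑ)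
    nonzero i j ∣i-j∣≡1 D≉0 X≈0 = *-≉0 D≉0 (irreducible i j ∣i-j∣≡1) (begin
      (x₂ + x₃ * θ* j) * M i j                                ≈⟨ trans (+-congʳ (zeroʳ _)) (+-identityˡ _) ⟨
      (x₀ + x₁ * θ* j) * 0# + (x₂ + x₃ * θ* j) * M i j        ≈⟨ +-congʳ (*-congˡ (δ-≢ j≢i)) ⟨
      (x₀ + x₁ * θ* j) * δ j i + (x₂ + x₃ * θ* j) * M i j     ≈⟨ entry i j ⟨
      κ (X $ b* j) i                                          ≈⟨ coord-cong b*-isBasis (X≈0 (b* j)) i ⟩
      κ 0ᴹ i                                                  ≈⟨ coord-0 b*-isBasis i ⟩
      0#                                                      ∎)
      where
      open ≈-R
      j≢i : j ≢ i
      j≢i ≡.refl = contradiction (≡.trans (≡.sym (ℕ.∣n-n∣≡0 (toℕ i))) ∣i-j∣≡1) λ()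

    zeroDiagonalSpaceNonzero : ∀ i j → ∣ toℕ i - toℕ j ∣ ≡ 1 → x₂ + x₃ * θ* j ≉ 0# →
      (∀ i → (x₀ + x₁ * θ* i) + (x₂ + x₃ * θ* i) * a i ≈ 0#) → ZeroDiagonalSpaceNonzero Φ
    zeroDiagonalSpaceNonzero i j ∣i-j∣≡1 D≉0 diagonal =
      X , zeroDiagonalSpace diagonal , nonzero i j ∣i-j∣≡1 D≉0

  -- Split vectors expanded in the eigenbasis of A*.

  module _ (split : SplitSequences Φ) where
    open SplitSequences split using (isFirst) renaming (first to φ)

    private
      u₀ = b* zero

      module U = SplitVectors F V d A θ
        (IsTridiagonalDiagonalBasis.isBasis (proj₂ (proj₂ (proj₂ isStandardOrdering))))
        (proj₂ ∘ proj₁ (proj₂ (proj₂ isStandardOrdering)))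

      u : ℕ → Carrierᴹ
      u = U.split u₀

      A*-u : ∀ (i : Fin d) → A* $ u (suc (toℕ i)) ≈ᴹ θ* (suc i) *ₗ u (suc (toℕ i)) +ᴹ φ i *ₗ u (toℕ i)
      A*-u i = begin
        A* $ u (suc (toℕ i))
          ≈⟨ End.⟦⟧-cong A* (U.splitVector≈split u₀ (suc i)) ⟨
        A* $ splitVector A θ u₀ (suc i)
          ≈⟨ isFirst u₀ (proj₁ (b*-eigenvector zero))
               (u₀ , ≈ᴹ-sym (fixes u₀ (proj₂ (b*-eigenvector zero)))) i ⟩
        θ* (suc i) *ₗ splitVector A θ u₀ (suc i) +ᴹ φ i *ₗ splitVector A θ u₀ (inject₁ i)
          ≈⟨ +ᴹ-cong (*ₗ-cong refl (U.splitVector≈split u₀ (suc i)))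
                     (*ₗ-cong refl (≈ᴹ-trans (U.splitVector≈split u₀ (inject₁ i))
                        (≈ᴹ-reflexive (≡.cong u (toℕ-inject₁ i))))) ⟩
        θ* (suc i) *ₗ u (suc (toℕ i)) +ᴹ φ i *ₗ u (toℕ i) ∎
        where
        open ≈ᴹ-R
        open IsProjection (proj₂ (isPrimitiveIdempotent* zero))

      κ-u-suc : ∀ n i → κ (u (suc n)) i ≈ Σ.sum (λ j → κ (u n) j * M i j) - U.t n * κ (u n) i
      κ-u-suc n i = trans (coord-−*ₗ b*-isBasis _ (U.t n) (u n) i) (+-congʳ (κ-A (u n) i))

      gap : ∀ {m n} → suc m < n → 1 < ∣ m - n ∣
      gap {zero}  {suc n} m+1<n = m+1<n
      gap {suc m} {suc n} m+1<n = gap {m} {n} (ℕ.s<s⁻¹ m+1<n)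

      gap′ : ∀ {m n} → suc m < n → 1 < ∣ n - m ∣
      gap′ {m} {n} m+1<n = ≡.subst (1 <_) (ℕ.∣-∣-comm m n) (gap m+1<n)

      -- Each factor A - θₖ reaches at most one index further, because A is tridiagonal, and u₀
      -- starts at index 0.
      support : ∀ n i → n < toℕ i → κ (u n) i ≈ 0#
      support zero i 0<i = trans
        (coord-basis b*-isBasis zero i)
        (δ-≢ {i = zero} {i} λ { ≡.refl → contradiction 0<i λ() })
      support (suc n) i n+1<i = begin
        κ (u (suc n)) i
          ≈⟨ κ-u-suc n i ⟩
        Σ.sum (λ j → κ (u n) j * M i j) - U.t n * κ (u n) i
          ≈⟨ +-cong (⊕.sum-zero _ term)
               (-‿cong (trans (*-congˡ (support n i (ℕ.<-trans (ℕ.n<1+n n) n+1<i))) (zeroʳ _))) ⟩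
        0# - 0#
          ≈⟨ -‿inverseʳ 0# ⟩
        0# ∎
        where
        open ≈-R
        term : ∀ j → κ (u n) j * M i j ≈ 0#
        term j with toℕ j ℕ.≤? n
        ... | yes j≤n = trans (*-congˡ (tridiagonal i j (gap′ (ℕ.≤-<-trans (ℕ.s≤s j≤n) n+1<i)))) (zeroʳ _)
        ... | no  j≰n = trans (*-congʳ (support n j (ℕ.≰⇒> j≰n))) (zeroˡ _)

      -- By `support` this is the top coefficient of uᵢ.
      β : Vector Carrier (suc d)
      β i = κ (u (toℕ i)) i

      -- The coefficient of uᵢ₊₁ just below its top one. For i = d the vector is u_{d+1}, which is
      -- zero.
      γ : Vector Carrier (suc d)
      γ i = κ (u (suc (toℕ i))) i

      inject₁-∣-∣ : ∀ (i : Fin d) → ∣ suc (toℕ i) - toℕ (inject₁ i) ∣ ≡ 1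
      inject₁-∣-∣ i = ≡.trans (≡.cong (∣ suc (toℕ i) -_∣) (toℕ-inject₁ i)) (step (toℕ i))
        where
        step : ∀ n → ∣ suc n - n ∣ ≡ 1
        step zero    = ≡.refl
        step (suc n) = step n

      below : ∀ (i : Fin d) {j} → j ≢ inject₁ i → toℕ j ℕ.≤ toℕ i → toℕ j < toℕ i
      below i j≢i j≤i = ℕ.≤∧≢⇒< j≤i λ j≡i → j≢i (toℕ-injective (≡.trans j≡i (≡.sym (toℕ-inject₁ i))))

      -- Only the top coefficient of uᵢ can reach index i + 1 under A - θᵢ.
      β-suc : ∀ i → β (suc i) ≈ β (inject₁ i) * M (suc i) (inject₁ i)
      β-suc i = begin
        κ (u (suc (toℕ i))) (suc i)
          ≈⟨ κ-u-suc (toℕ i) (suc i) ⟩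
        Σ.sum (λ j → κ (u (toℕ i)) j * M (suc i) j) - U.t (toℕ i) * κ (u (toℕ i)) (suc i)
          ≈⟨ +-cong (⊕.sum-single _ (inject₁ i) term)
               (-‿cong (trans (*-congˡ (support (toℕ i) (suc i) (ℕ.n<1+n _))) (zeroʳ _))) ⟩
        κ (u (toℕ i)) (inject₁ i) * M (suc i) (inject₁ i) - 0#
          ≈⟨ trans (+-congˡ -0#≈0#) (+-identityʳ _) ⟩
        κ (u (toℕ i)) (inject₁ i) * M (suc i) (inject₁ i)
          ≡⟨ ≡.cong (λ n → κ (u n) (inject₁ i) * M (suc i) (inject₁ i)) (toℕ-inject₁ i) ⟨
        β (inject₁ i) * M (suc i) (inject₁ i) ∎
        where
        open ≈-R
        term : ∀ j → j ≢ inject₁ i → κ (u (toℕ i)) j * M (suc i) j ≈ 0#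
        term j j≢i with toℕ j ℕ.≤? toℕ i
        ... | yes j≤i = trans (*-congˡ (tridiagonal (suc i) j (gap′ (ℕ.s<s (below i j≢i j≤i))))) (zeroʳ _)
        ... | no  j≰i = trans (*-congʳ (support (toℕ i) j (ℕ.≰⇒> j≰i))) (zeroˡ _)

      -- By `β-suc`, `β i` is a product of subdiagonal entries, starting from the coefficient 1 of
      -- u₀.
      β≉0 : ∀ i → β i ≉ 0#
      β≉0 = <-weakInduction (λ i → β i ≉ 0#) base step
        where
        base : β zero ≉ 0#
        base β≈0 = 1≉0 (trans (sym (trans (coord-basis b*-isBasis zero zero) (δ-refl {suc d} zero))) β≈0)
        step : ∀ i → β (inject₁ i) ≉ 0# → β (suc i) ≉ 0#
        step i ih β≈0 = *-≉0 ih (irreducible (suc i) (inject₁ i) (inject₁-∣-∣ i)) (trans (sym (β-suc i)) β≈0)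

      -- Compare coefficients at index i in A* uᵢ₊₁: the eigenbasis gives θ*ᵢ γᵢ, the split relation
      -- gives θ*ᵢ₊₁ γᵢ + φᵢ₊₁ βᵢ.
      γ-inject₁ : ∀ i → γ (inject₁ i) * (θ* (suc i) - θ* (inject₁ i)) ≈ - (φ i * β (inject₁ i))
      γ-inject₁ i rewrite toℕ-inject₁ i = begin
        g * (θ* (suc i) - θ* (inject₁ i))
          ≈⟨ solve 3 (λ g s t → g :* (s :- t) := s :* g :- t :* g) refl g (θ* (suc i)) (θ* (inject₁ i)) ⟩
        θ* (suc i) * g - θ* (inject₁ i) * g
          ≈⟨ +-congˡ (-‿cong (trans (sym (κ-A* _ (inject₁ i)))
               (trans (coord-cong b*-isBasis (A*-u i) (inject₁ i))
               (trans (coord-+ b*-isBasis _ _ _) (+-cong (coord-*ₗ b*-isBasis _ _ _) (coord-*ₗ b*-isBasis _ _ _)))))) ⟩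
        θ* (suc i) * g - (θ* (suc i) * g + φ i * κ (u (toℕ i)) (inject₁ i))
          ≈⟨ solve 2 (λ x y → x :- (x :+ y) := :- y) refl (θ* (suc i) * g) (φ i * κ (u (toℕ i)) (inject₁ i)) ⟩
        - (φ i * κ (u (toℕ i)) (inject₁ i)) ∎
        where
        open ≈-R
        g = κ (u (suc (toℕ i))) (inject₁ i)

      γ-last : γ (fromℕ d) ≈ 0#
      γ-last rewrite toℕ-fromℕ d = trans (coord-cong b*-isBasis (U.split-end u₀) _) (coord-0 b*-isBasis _)

      γ-zero : γ zero ≈ β zero * (a zero - θ zero)
      γ-zero = begin
        γ zero
          ≈⟨ κ-u-suc 0 zero ⟩
        Σ.sum (λ j → κ u₀ j * M zero j) - θ zero * β zero
          ≈⟨ +-congʳ (⊕.sum-single (λ j → κ u₀ j * M zero j) zero λ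
               { zero    0≢0 → contradiction ≡.refl 0≢0
               ; (suc j) _ → trans (*-congʳ (support 0 (suc j) ℕ.z<s)) (zeroˡ _) }) ⟩
        β zero * a zero - θ zero * β zero
          ≈⟨ solve 3 (λ b a t → b :* a :- t :* b := b :* (a :- t)) refl (β zero) (a zero) (θ zero) ⟩
        β zero * (a zero - θ zero) ∎
        where
        open ≈-R

      -- In row i + 1 of A, tridiagonality removes the indices below i and `support` those above i +
      -- 1, so two terms of the sum remain.
      γ-suc : ∀ i → γ (suc i) ≈ β (suc i) * (a (suc i) - θ (suc i)) + γ (inject₁ i) * M (suc i) (inject₁ i)
      γ-suc i = begin
        γ (suc i)
          ≈⟨ κ-u-suc (suc (toℕ i)) (suc i) ⟩
        Σ.sum (λ j → κ (u (suc (toℕ i))) j * M (suc i) j) - U.t (suc (toℕ i)) * β (suc i)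
          ≈⟨ +-cong (⊕.sum-pair _ (suc i) (inject₁ i) distinct term)
               (-‿cong (*-congʳ (reflexive (U.t-toℕ (suc i))))) ⟩
        β (suc i) * a (suc i) + κ (u (suc (toℕ i))) (inject₁ i) * M (suc i) (inject₁ i) - θ (suc i) * β (suc i)
          ≈⟨ solve 4 (λ b a t x → b :* a :+ x :- t :* b := b :* (a :- t) :+ x) refl
               (β (suc i)) (a (suc i)) (θ (suc i)) _ ⟩
        β (suc i) * (a (suc i) - θ (suc i)) + κ (u (suc (toℕ i))) (inject₁ i) * M (suc i) (inject₁ i)
          ≡⟨ ≡.cong (λ n → β (suc i) * (a (suc i) - θ (suc i))
                           + κ (u (suc n)) (inject₁ i) * M (suc i) (inject₁ i)) (toℕ-inject₁ i) ⟨
        β (suc i) * (a (suc i) - θ (suc i)) + γ (inject₁ i) * M (suc i) (inject₁ i) ∎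
        where
        open ≈-R
        distinct : suc i ≢ inject₁ i
        distinct i+1≡i = ℕ.1+n≢n (≡.trans (≡.cong toℕ i+1≡i) (toℕ-inject₁ i))
        term : ∀ j → j ≢ suc i → j ≢ inject₁ i → κ (u (suc (toℕ i))) j * M (suc i) j ≈ 0#
        term j j≢i+1 j≢i with ℕ.<-cmp (toℕ j) (suc (toℕ i))
        ... | tri< j<i+1 _ _ = trans
          (*-congˡ (tridiagonal (suc i) j (gap′ (ℕ.s<s (below i j≢i (ℕ.s≤s⁻¹ j<i+1))))))
          (zeroʳ _)
        ... | tri≈ _ j≡i+1 _ = contradiction (toℕ-injective j≡i+1) j≢i+1
        ... | tri> _ _ j>i+1 = trans (*-congʳ (support (suc (toℕ i)) j j>i+1)) (zeroˡ _)

    -- f and Δ interpolate φ and the differences of θ*.  Setting φ₀ = φ_{d+1} = 0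
    -- covers the two ends, where Δ may vanish.
    diagonal-entry : (f Δ : ℕ → Carrier) → f 0 ≈ 0# → f (suc d) ≈ 0# →
      (∀ i → φ i ≈ f (suc (toℕ i))) →
      (∀ i → θ* (suc i) - θ* (inject₁ i) ≈ Δ (suc (toℕ i))) →
      ∀ i → ∃₂ λ x y → a i ≈ θ i + (x + y) ×
        x * Δ (toℕ i) ≈ f (toℕ i) × y * Δ (suc (toℕ i)) ≈ - f (suc (toℕ i))
    diagonal-entry f Δ f₀≈0 f₁₊d≈0 φ≈f Δθ*≈Δ i =
      let x , γ≈x , lower = lowerTerm i
          y , γ≈y , upper = upperTerm i
      -- The two expressions for `γ i`, one through `x` and one through `y`, are equated and the
      -- factor `β i` is cancelled.
      in x , y , *-cancelˡ-≉0 (β≉0 i) (begin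
           β i * a i
             ≈⟨ solve 4 (λ b a t x → b :* a := b :* (t :+ x) :+ (b :* (a :- t) :- b :* x)) refl (β i) (a i) (θ i) x ⟩
           β i * (θ i + x) + (β i * (a i - θ i) - β i * x)
             ≈⟨ +-congˡ (trans (sym γ≈x) γ≈y) ⟩
           β i * (θ i + x) + β i * y
             ≈⟨ solve 4 (λ b t x y → b :* (t :+ x) :+ b :* y := b :* (t :+ (x :+ y))) refl (β i) (θ i) x y ⟩
           β i * (θ i + (x + y)) ∎) , lower , upper
      where
      open ≈-R

      -- For i > 0 the witness is x = -γᵢ₋₁ m / βᵢ with m the subdiagonal entry. As βᵢ = βᵢ₋₁ m, it
      -- equals -γᵢ₋₁ / βᵢ₋₁, which `γ-inject₁` evaluates.
      lowerTerm : ∀ i → ∃ λ x → γ i ≈ β i * (a i - θ i) - β i * x × x * Δ (toℕ i) ≈ f (toℕ i)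
      lowerTerm zero = 0# ,
        trans γ-zero (sym (trans (+-congˡ (trans (-‿cong (zeroʳ _)) -0#≈0#)) (+-identityʳ _))) ,
        trans (zeroˡ _) (sym f₀≈0)
      lowerTerm (suc i) =
        let m = M (suc i) (inject₁ i)
            g = γ (inject₁ i)
            δ* = θ* (suc i) - θ* (inject₁ i)
            x , βx≈-gm = divide (- (g * m)) (β≉0 (suc i))
        in x , (begin
             γ (suc i)
               ≈⟨ γ-suc i ⟩
             β (suc i) * (a (suc i) - θ (suc i)) + g * m
               ≈⟨ +-congˡ (-‿involutive _) ⟨
             β (suc i) * (a (suc i) - θ (suc i)) - - (g * m)
               ≈⟨ +-congˡ (-‿cong βx≈-gm) ⟨
             β (suc i) * (a (suc i) - θ (suc i)) - β (suc i) * x ∎) ,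
           *-cancelˡ-≉0 (β≉0 (suc i)) (begin
             β (suc i) * (x * Δ (suc (toℕ i)))
               ≈⟨ *-assoc _ _ _ ⟨
             β (suc i) * x * Δ (suc (toℕ i))
               ≈⟨ *-cong βx≈-gm (sym (Δθ*≈Δ i)) ⟩
             - (g * m) * δ*
               ≈⟨ solve 3 (λ g m D → (:- (g :* m)) :* D := :- (g :* D) :* m) refl g m δ* ⟩
             - (g * δ*) * m
               ≈⟨ *-congʳ (trans (-‿cong (γ-inject₁ i)) (-‿involutive _)) ⟩
             φ i * β (inject₁ i) * m
               ≈⟨ *-assoc _ _ _ ⟩
             φ i * (β (inject₁ i) * m)
               ≈⟨ *-cong (φ≈f i) (sym (β-suc i)) ⟩
             f (suc (toℕ i)) * β (suc i)
               ≈⟨ *-comm _ _ ⟩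
             β (suc i) * f (suc (toℕ i)) ∎)

      -- The witness is y = γᵢ / βᵢ, evaluated by `γ-inject₁`; at i = d it is 0 because u_{d+1} = 0.
      upperTerm : ∀ i → ∃ λ y → γ i ≈ β i * y × y * Δ (suc (toℕ i)) ≈ - f (suc (toℕ i))
      upperTerm i with view i
      ... | ‵fromℕ = 0# , trans γ-last (sym (zeroʳ _)) , (begin
        0# * Δ (suc (toℕ (fromℕ d)))   ≈⟨ zeroˡ _ ⟩
        0#                             ≈⟨ -0#≈0# ⟨
        - 0#                           ≈⟨ -‿cong f₁₊d≈0 ⟨
        - f (suc d)                    ≡⟨ ≡.cong (λ n → - f (suc n)) (toℕ-fromℕ d) ⟨
        - f (suc (toℕ (fromℕ d)))      ∎)
      ... | ‵inject₁ i =
        let y , βy≈γ = divide (γ (inject₁ i)) (β≉0 (inject₁ i))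
        in y , sym βy≈γ , *-cancelˡ-≉0 (β≉0 (inject₁ i)) (begin
             β (inject₁ i) * (y * Δ (suc (toℕ (inject₁ i))))
               ≡⟨ ≡.cong (λ n → β (inject₁ i) * (y * Δ (suc n))) (toℕ-inject₁ i) ⟩
             β (inject₁ i) * (y * Δ (suc (toℕ i)))
               ≈⟨ *-assoc _ _ _ ⟨
             β (inject₁ i) * y * Δ (suc (toℕ i))
               ≈⟨ *-cong βy≈γ (sym (Δθ*≈Δ i)) ⟩
             γ (inject₁ i) * (θ* (suc i) - θ* (inject₁ i))
               ≈⟨ γ-inject₁ i ⟩
             - (φ i * β (inject₁ i))
               ≈⟨ -‿cong (*-congʳ (φ≈f i)) ⟩
             - (f (suc (toℕ i)) * β (inject₁ i))
               ≈⟨ solve 2 (λ f b → :- (f :* b) := b :* (:- f)) refl (f (suc (toℕ i))) (β (inject₁ i)) ⟩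
             β (inject₁ i) * - f (suc (toℕ i))
               ≡⟨ ≡.cong (λ n → β (inject₁ i) * - f (suc n)) (toℕ-inject₁ i) ⟨
             β (inject₁ i) * - f (suc (toℕ (inject₁ i))) ∎)

    -- D i is a common multiple of the two denominators in aᵢ, so the last
    -- equation says that (x₀ + x₁ θ*ᵢ) + D i aᵢ = 0 after clearing them.
    nonzero-from-split : (f Δ c c′ : ℕ → Carrier) (x₀ x₁ x₂ x₃ : Carrier) →
      f 0 ≈ 0# → f (suc d) ≈ 0# →
      (∀ i → φ i ≈ f (suc (toℕ i))) →
      (∀ i → θ* (suc i) - θ* (inject₁ i) ≈ Δ (suc (toℕ i))) →
      let D = λ i → x₂ + x₃ * θ* i in
      (∀ i → D i ≈ c (toℕ i) * Δ (toℕ i)) →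
      (∀ i → D i ≈ c′ (toℕ i) * Δ (suc (toℕ i))) →
      (∀ i → (x₀ + x₁ * θ* i) + D i * θ i
             + (c (toℕ i) * f (toℕ i) - c′ (toℕ i) * f (suc (toℕ i))) ≈ 0#) →
      ∀ i j → ∣ toℕ i - toℕ j ∣ ≡ 1 → D j ≉ 0# → ZeroDiagonalSpaceNonzero Φ
    nonzero-from-split f Δ c c′ x₀ x₁ x₂ x₃ f₀≈0 f₁₊d≈0 φ≈f Δθ*≈Δ D≈cΔ D≈c′Δ vanish i j ∣i-j∣≡1 Dj≉0 =
      zeroDiagonalSpaceNonzero x₀ x₁ x₂ x₃ i j ∣i-j∣≡1 Dj≉0 diagonal
      where
      D : Vector Carrier (suc d)
      D i = x₂ + x₃ * θ* i

      diagonal : ∀ i → (x₀ + x₁ * θ* i) + D i * a i ≈ 0#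
      move : ∀ c d x → c * d * x ≈ c * (x * d)
      move = solve 3 (λ c d x → c :* d :* x := c :* (x :* d)) refl

      collect : ∀ B D t x y → B + D * (t + (x + y)) ≈ B + D * t + (D * x + D * y)
      collect = solve 5 (λ B D t x y → B :+ D :* (t :+ (x :+ y)) := B :+ D :* t :+ (D :* x :+ D :* y)) refl

      diagonal i =
        let x , y , a≈ , xΔ≈f , yΔ≈-f = diagonal-entry f Δ f₀≈0 f₁₊d≈0 φ≈f Δθ*≈Δ i
            n = toℕ i
            B = x₀ + x₁ * θ* i
        in begin
        B + D i * a i
          ≈⟨ +-congˡ (*-congˡ a≈) ⟩
        B + D i * (θ i + (x + y))
          ≈⟨ collect B (D i) (θ i) x y ⟩
        B + D i * θ i + (D i * x + D i * y)
          ≈⟨ +-congˡ (+-cong (*-congʳ (D≈cΔ i)) (*-congʳ (D≈c′Δ i))) ⟩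
        B + D i * θ i + (c n * Δ n * x + c′ n * Δ (suc n) * y)
          ≈⟨ +-congˡ (+-cong (move (c n) (Δ n) x) (move (c′ n) (Δ (suc n)) y)) ⟩
        B + D i * θ i + (c n * (x * Δ n) + c′ n * (y * Δ (suc n)))
          ≈⟨ +-congˡ (+-cong (*-congˡ xΔ≈f) (trans (*-congˡ yΔ≈-f) (sym (-‿distribʳ-* _ _)))) ⟩
        B + D i * θ i + (c n * f n - c′ n * f (suc n))
          ≈⟨ vanish i ⟩
        0# ∎
        where
        open ≈-R

-- Integer powers of q.

module IntegerPowers {c ℓ} (F : Field c ℓ) (q : Field.Carrier F)
  (q≉0 : Field._≉_ F q (Field.0# F)) where
  open Field F hiding (zero)
  open FieldNotions F
  open Algebra.Properties.Semiring.Exp semiring using (^-homo-*)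
  open IntegerCoefficients commutativeRing using (solve; _:=_; _:*_)
  open Relation.Binary.Reasoning.Setoid setoid

  q⁻¹ : Carrier
  q⁻¹ = proj₁ (inverse q q≉0)

  qq⁻¹≈1 : q * q⁻¹ ≈ 1#
  qq⁻¹≈1 = proj₂ (proj₂ (inverse q q≉0))

  q⁻¹≉0 : q⁻¹ ≉ 0#
  q⁻¹≉0 q⁻¹≈0 = 1≉0 (trans (sym qq⁻¹≈1) (trans (*-congˡ q⁻¹≈0) (zeroʳ q)))

  zpow-neg : ∀ n → zpow q q≉0 (ℤ.- (+ n)) ≈ q⁻¹ ^ n
  zpow-neg zero    = refl
  zpow-neg (suc n) = refl

  -- Exponents of mixed sign are brought to the form m ⊖ n, so that only natural powers of q and
  -- `q⁻¹` reach the solver.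
  zpow-⊖ : ∀ m n → zpow q q≉0 (m ⊖ n) ≈ q ^ m * q⁻¹ ^ n
  zpow-⊖ m       zero    = sym (*-identityʳ _)
  zpow-⊖ zero    (suc n) = sym (*-identityˡ _)
  zpow-⊖ (suc m) (suc n) = begin
    zpow q q≉0 (suc m ⊖ suc n)          ≡⟨ ≡.cong (zpow q q≉0) (ℤ.[1+m]⊖[1+n]≡m⊖n m n) ⟩
    zpow q q≉0 (m ⊖ n)                  ≈⟨ zpow-⊖ m n ⟩
    q ^ m * q⁻¹ ^ n                     ≈⟨ *-identityˡ _ ⟨
    1# * (q ^ m * q⁻¹ ^ n)              ≈⟨ *-congʳ qq⁻¹≈1 ⟨
    q * q⁻¹ * (q ^ m * q⁻¹ ^ n)         ≈⟨ solve 4 (λ a b c d → a :* b :* (c :* d) := a :* c :* (b :* d))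
                                             refl q q⁻¹ (q ^ m) (q⁻¹ ^ n) ⟩
    q ^ suc m * q⁻¹ ^ suc n             ∎

  qⁿq⁻ⁿ≈1 : ∀ n → q ^ n * q⁻¹ ^ n ≈ 1#
  qⁿq⁻ⁿ≈1 n = trans (sym (zpow-⊖ n n)) (reflexive (≡.cong (zpow q q≉0) (ℤ.n⊖n≡0 n)))

  zpow-1-2n : ∀ n → zpow q q≉0 (+ 1 ℤ.- + 2 ℤ.* + n) ≈ q * (q⁻¹ ^ n * q⁻¹ ^ n)
  zpow-1-2n n = begin
    zpow q q≉0 (+ 1 ℤ.- + 2 ℤ.* + n)  ≡⟨ ≡.cong (zpow q q≉0) (≡.trans
                                           (≡.cong (ℤ._-_ (+ 1)) (≡.sym (ℤ.pos-* 2 n)))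
                                           (ℤ.m-n≡m⊖n 1 (2 ℕ.* n))) ⟩
    zpow q q≉0 (1 ⊖ (2 ℕ.* n))        ≈⟨ zpow-⊖ 1 (2 ℕ.* n) ⟩
    q ^ 1 * q⁻¹ ^ (n ℕ.+ (n ℕ.+ 0))   ≡⟨ ≡.cong (λ k → q ^ 1 * q⁻¹ ^ (n ℕ.+ k)) (ℕ.+-identityʳ n) ⟩
    q ^ 1 * q⁻¹ ^ (n ℕ.+ n)           ≈⟨ *-cong (*-identityʳ q) (^-homo-* q⁻¹ n n) ⟩
    q * (q⁻¹ ^ n * q⁻¹ ^ n)           ∎

  zpow-n-d-1 : ∀ n d → zpow q q≉0 (+ n ℤ.- + d ℤ.- + 1) ≈ q ^ n * q⁻¹ ^ suc d
  zpow-n-d-1 n d = begin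
    zpow q q≉0 (+ n ℤ.- + d ℤ.- + 1)  ≡⟨ ≡.cong (zpow q q≉0) exponent ⟩
    zpow q q≉0 (n ⊖ suc d)            ≈⟨ zpow-⊖ n (suc d) ⟩
    q ^ n * q⁻¹ ^ suc d               ∎
    where
    exponent : + n ℤ.- + d ℤ.- + 1 ≡ n ⊖ suc d
    exponent = ≡.trans (ℤ.+-assoc (+ n) (ℤ.- + d) (ℤ.- + 1))
      (≡.trans (≡.cong (ℤ._+_ (+ n)) (≡.sym (ℤ.neg-distrib-+ (+ d) (+ 1))))
        (≡.trans (ℤ.m-n≡m⊖n n (d ℕ.+ 1)) (≡.cong (n ⊖_) (ℕ.+-comm d 1))))

-- The three types: choice of the coefficients of X.

module NonzeroByType {c ℓ m ℓm} (F : Field c ℓ) (V : VectorSpace F m ℓm) {e : ℕ}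
  (Φ : Leonard.LeonardSystem F V (suc (suc e))) (split : Leonard.SplitSequences F V Φ) where
  open Leonard F V
  open Field F hiding (zero)
  open FieldNotions F
  open FieldProperties F
  open LeonardSystem Φ using (θ; θ*)
  open Algebra.Properties.AbelianGroup +-abelianGroup using (inverseˡ-unique; x∙y⁻¹≈ε⇒x≈y)
  open SplitSequences split using () renaming (first to φ)
  open LeonardSystemProperties F V Φ using (nonzero-from-split)
  open IntegerCoefficients commutativeRing using (Polynomial; solve; con; _:=_; _:+_; _:*_; _:-_; :-_)
  open Relation.Binary.Reasoning.Setoid setoid

  private
    d : ℕ
    d = suc (suc e)

    θ₀ θ₀* dᶠ 2# : Carrier
    θ₀  = θ zero
    θ₀* = θ* zero
    dᶠ  = ⟦ d ⟧
    2#  = 1# + 1#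

    ∶1 ∶2 ∶4 : ∀ {n} → Polynomial n
    ∶1 = con (+ 1)
    ∶2 = ∶1 :+ ∶1
    ∶4 = ∶2 :* ∶2

    difference : (g : ℕ → Carrier) → (∀ i → θ* i ≈ g (toℕ i)) →
      ∀ (i : Fin d) → θ* (suc i) - θ* (inject₁ i) ≈ g (suc (toℕ i)) - g (toℕ i)
    difference g θ*≈g i = +-cong (θ*≈g (suc i))
      (-‿cong (trans (θ*≈g (inject₁ i)) (reflexive (≡.cong g (toℕ-inject₁ i)))))

  -- Since `f n - f (suc n)` is r (d - 2n) and the gap of θ* is the constant s*, aᵢ is affine in i.
  -- Taking s* s* as the denominator, and not s*, keeps `x₁` free of division.
  krawtchouk : IsKrawtchouk Φ split → ZeroDiagonalSpaceNonzero Φ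
  krawtchouk isKrawtchouk = nonzero-from-split split f (λ _ → s*) (λ _ → s*) (λ _ → s*) x₀ x₁ (s* * s*) 0#
    (solve 2 (λ r d → r :* con (+ 0) :* (con (+ 0) :- d :- ∶1) := con (+ 0)) refl r dᶠ)
    (solve 2 (λ r d → r :* (∶1 :+ d) :* (∶1 :+ d :- d :- ∶1) := con (+ 0)) refl r dᶠ)
    varphi-eq
    (λ i → trans (difference (λ n → θ₀* + s* * ⟦ n ⟧) θ*-eq i)
      (solve 3 (λ t s n → t :+ s :* (∶1 :+ n) :- (t :+ s :* n) := s) refl θ₀* s* ⟦ toℕ i ⟧))
    (λ i → D≈ (θ* i))
    (λ i → D≈ (θ* i))
    (λ i → trans (+-congʳ (+-cong (+-congˡ (*-congˡ (θ*-eq i))) (*-cong (+-congˡ (*-congˡ (θ*-eq i))) (θ-eq i))))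
      (solve 7 (λ t t* s s* r d n →
        let x₁ = ∶2 :* r :- s :* s*
            f = λ n → r :* n :* (n :- d :- ∶1)
            T = t* :+ s* :* n
        in (:- (s* :* (s* :* t :+ r :* d)) :- x₁ :* t* :+ x₁ :* T) :+ (s* :* s* :+ con (+ 0) :* T) :* (t :+ s :* n)
             :+ (s* :* f n :- s* :* f (∶1 :+ n)) := con (+ 0)) refl θ₀ θ₀* s s* r dᶠ ⟦ toℕ i ⟧))
    zero (suc zero) ≡.refl
    (λ D≈0 → *-≉0 s*≉0 s*≉0 (trans (sym (D≈ (θ* (suc zero)))) D≈0))
    where
    open IsKrawtchouk isKrawtchouk
    f : ℕ → Carrier
    f n = r * ⟦ n ⟧ * (⟦ n ⟧ - dᶠ - 1#)
    x₀ x₁ : Carrier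
    x₁ = 2# * r - s * s*
    x₀ = - (s* * (s* * θ₀ + r * dᶠ)) - x₁ * θ₀*
    D≈ : ∀ T → s* * s* + 0# * T ≈ s* * s*
    D≈ T = trans (+-congˡ (zeroˡ T)) (+-identityʳ _)

  -- The product of the two adjacent gaps is affine in θ*, because (2n + s*)(2n + 2 + s*) = 4n(n + 1
  -- + s*) + s*(2 + s*). This fixes `x₂` and `x₃`.
  hahn : IsHahn Φ split → ZeroDiagonalSpaceNonzero Φ
  hahn isHahn = nonzero-from-split split f Δ (λ n → Δ (suc n)) Δ x₀ x₁ x₂ x₃
    (solve 4 (λ h s r d → h :* s :* con (+ 0) :* (con (+ 0) :- d :- ∶1) :* (con (+ 0) :+ r) := con (+ 0))
       refl h* s r dᶠ)
    (solve 4 (λ h s r d → h :* s :* (∶1 :+ d) :* (∶1 :+ d :- d :- ∶1) :* (∶1 :+ d :+ r) := con (+ 0))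
       refl h* s r dᶠ)
    varphi-eq
    (λ i → trans (difference (λ n → θ₀* + h* * ⟦ n ⟧ * (⟦ n ⟧ + 1# + s*)) θ*-eq i)
      (solve 4 (λ t h s n → t :+ h :* (∶1 :+ n) :* (∶1 :+ n :+ ∶1 :+ s) :- (t :+ h :* n :* (n :+ ∶1 :+ s))
         := h :* (∶2 :* (∶1 :+ n) :+ s)) refl θ₀* h* s* ⟦ toℕ i ⟧))
    D≈
    (λ i → trans (D≈ i) (*-comm _ _))
    (λ i → trans (+-congʳ (+-cong (+-congˡ (*-congˡ (θ*-eq i))) (*-cong (+-congˡ (*-congˡ (θ*-eq i))) (θ-eq i))))
      (solve 8 (λ t t* h s s* r d n →
        let Δ = λ n → h :* (∶2 :* n :+ s*)
            f = λ n → h :* s :* n :* (n :- d :- ∶1) :* (n :+ r)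
            α = s* :+ ∶2 :* d :- ∶2 :* r
            x₃ = ∶4 :* h
            x₂ = h :* h :* s* :* (∶2 :+ s*) :- x₃ :* t*
            x₁ = :- (x₃ :* t :+ h :* s :* α)
            x₀ = h :* s :* α :* t* :- x₂ :* t :- h :* h :* s :* d :* (∶1 :+ r) :* s*
            T = t* :+ h :* n :* (n :+ ∶1 :+ s*)
        in (x₀ :+ x₁ :* T) :+ (x₂ :+ x₃ :* T) :* (t :+ s :* n)
             :+ (Δ (∶1 :+ n) :* f n :- Δ n :* f (∶1 :+ n)) := con (+ 0)) refl θ₀ θ₀* h* s s* r dᶠ ⟦ toℕ i ⟧))
    -- Index 1 is chosen because the denominator at index 0 has the factor s*, which may be zero. At
    -- index 1 its factors are s* + 2 and s* + 4, both excluded from vanishing.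
    zero (suc zero) ≡.refl
    (λ D≈0 → *-≉0 (*-≉0 h*≉0 (s*+n≉0 4 (ℕ.s≤s (ℕ.s≤s ℕ.z≤n)) (ℕ.*-monoʳ-≤ 2 (ℕ.s≤s (ℕ.s≤s (ℕ.z≤n {e}))))))
                  (*-≉0 h*≉0 (s*+n≉0 2 ℕ.≤-refl
                    (ℕ.≤-trans (ℕ.m≤m+n 2 2) (ℕ.*-monoʳ-≤ 2 (ℕ.s≤s (ℕ.s≤s (ℕ.z≤n {e})))))))
      (trans (sym (trans (D≈ (suc zero))
        -- The numerals are spelled out the way `⟦ n ⟧` unfolds, ending in `0#`.
        (solve 2 (λ h s → h :* (∶2 :* (∶1 :+ (∶1 :+ con (+ 0))) :+ s) :* (h :* (∶2 :* (∶1 :+ con (+ 0)) :+ s))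
           := h :* (s :+ (∶1 :+ (∶1 :+ (∶1 :+ (∶1 :+ con (+ 0)))))) :* (h :* (s :+ (∶1 :+ (∶1 :+ con (+ 0))))))
           refl h* s*))) D≈0))
    where
    open IsHahn isHahn
    f Δ : ℕ → Carrier
    f n = h* * s * ⟦ n ⟧ * (⟦ n ⟧ - dᶠ - 1#) * (⟦ n ⟧ + r)
    Δ n = h* * (2# * ⟦ n ⟧ + s*)
    -- The cubic terms in n cancel in D (aᵢ - θ₀), leaving h* h* s (α n(n + 1 + s*) + d(1 + r) s*).
    -- The first summand determines `x₁`, the value at n = 0 then determines `x₀`.
    α x₀ x₁ x₂ x₃ : Carrier
    α = s* + 2# * dᶠ - 2# * r
    x₃ = 2# * 2# * h*
    x₂ = h* * h* * s* * (2# + s*) - x₃ * θ₀*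
    x₁ = - (x₃ * θ₀ + h* * s * α)
    x₀ = h* * s * α * θ₀* - x₂ * θ₀ - h* * h* * s * dᶠ * (1# + r) * s*
    D≈ : ∀ i → x₂ + x₃ * θ* i ≈ Δ (suc (toℕ i)) * Δ (toℕ i)
    D≈ i = trans (+-congˡ (*-congˡ (θ*-eq i)))
      (solve 4 (λ t h s n → h :* h :* s :* (∶2 :+ s) :- ∶4 :* h :* t :+ ∶4 :* h :* (t :+ h :* n :* (n :+ ∶1 :+ s))
        := h :* (∶2 :* (∶1 :+ n) :+ s) :* (h :* (∶2 :* n :+ s))) refl θ₀* h* s* ⟦ toℕ i ⟧)
    s*+n≉0 : ∀ n → 2 ℕ.≤ n → n ℕ.≤ 2 ℕ.* d → s* + ⟦ n ⟧ ≉ 0#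
    s*+n≉0 n 2≤n n≤2d s*+n≈0 = s*≉-i n 2≤n n≤2d (inverseˡ-unique s* ⟦ n ⟧ s*+n≈0)

  -- With y = q⁻ⁿ, the gap `Δ n` is itself affine in θ*, and `Δ (suc n)` is `Δ n` divided by q,
  -- whence the cofactors 1 and q. The term h h* (1 - q) y² in D θᵢ cancels against
  -- `f n - q * f (suc n)`, which is h h* (1 - q)(q⁻ᵈ - y²). What remains is affine in y, and its
  -- two coefficients give `x₁` and `x₀`.
  dualqKrawtchouk : IsDualqKrawtchouk Φ split → ZeroDiagonalSpaceNonzero Φ
  dualqKrawtchouk isDualqKrawtchouk = nonzero-from-split split f Δ (λ _ → 1#) (λ _ → q) x₀ x₁ x₂ x₃
    (solve 2 (λ x w → x :* (∶1 :- ∶1) :* (∶1 :- w) := con (+ 0)) refl (h * h* * q) (p ^ suc d))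
    (solve 2 (λ x w → x :* (w :- ∶1) :* (w :- w) := con (+ 0)) refl (h * h* * q) (p ^ suc d))
    φ≈f
    (λ i → trans (difference (λ n → θ₀* + h* * (p ^ n - 1#)) θ*≈ i)
      (modulo qq⁻¹≈1 (solve 5 (λ t h q p y → t :+ h :* (p :* y :- ∶1) :- (t :+ h :* (y :- ∶1))
        := h :* (p :* y) :* (∶1 :- q) :+ (q :* p :- ∶1) :* (h :* y)) refl θ₀* h* q p (p ^ toℕ i))))
    (λ i → trans (D≈Δ i) (sym (*-identityˡ _)))
    (λ i → trans (D≈Δ i) (modulo qq⁻¹≈1 (solve 4 (λ h q p y → h :* y :* (∶1 :- q)
        := q :* (h :* (p :* y) :* (∶1 :- q)) :+ (q :* p :- ∶1) :* (:- (h :* y :* (∶1 :- q)))) refl h* q p (p ^ toℕ i))))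
    (λ i → trans (+-congʳ (+-cong (+-congˡ (*-congˡ (θ*≈ i))) (*-cong (+-congˡ (*-congˡ (θ*≈ i))) (θ≈ i))))
      (modulo (qⁿq⁻ⁿ≈1 (toℕ i)) (modulo qq⁻¹≈1 (solve 10 (λ t t* h h* s q p w y z →
        let x₃ = ∶1 :- q
            x₂ = (∶1 :- q) :* (h* :- t*)
            x₁ = :- ((∶1 :- q) :* (t :- h :* (∶1 :+ s :* q)))
            x₀ = (h* :- t*) :* x₁ :- h :* h* :* (∶1 :- q) :* (w :+ s :* q)
            f = λ y → h :* h* :* q :* (y :- ∶1) :* (y :- p :* w)
            T = t* :+ h* :* (y :- ∶1)
        in (x₀ :+ x₁ :* T) :+ (x₂ :+ x₃ :* T) :* (t :+ h :* (∶1 :- z) :* (∶1 :- s :* (z :* q)) :* y)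
             :+ (∶1 :* f y :- q :* f (p :* y))
           -- To the solver z = qⁿ and y = q⁻ⁿ are independent variables, and so are q and p. The
           -- next two lines give the cofactors of z y - 1 and q p - 1.
           := con (+ 0)
             :+ (z :* y :- ∶1) :* (h :* h* :* (∶1 :- q) :* (y :* (s :* q :* z :- ∶1 :- s :* q) :+ s :* q))
             :+ (q :* p :- ∶1) :* (h :* h* :* (:- (w :* (y :- ∶1)) :- ((q :* p :+ ∶1) :* y :- q) :* (y :- w))))
        refl θ₀ θ₀* h h* s q p (p ^ d) (p ^ toℕ i) (q ^ toℕ i)))))
    zero (suc zero) ≡.refl
    (λ D≈0 → *-≉0 (*-≉0 h*≉0 (*-≉0 q⁻¹≉0 1≉0)) 1-q≉0 (trans (sym (D≈Δ (suc zero))) D≈0))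
    where
    open IsDualqKrawtchouk isDualqKrawtchouk
    open IntegerPowers F q q≉0 renaming (q⁻¹ to p)
    open Algebra.Properties.Semiring.Exp semiring using (^-homo-*)
    -- Absorbing q⁻²ⁿ into the two factors of φ makes `f` a polynomial in `p ^ n` whose zeros at n =
    -- 0 and n = d + 1 are visible.
    f Δ : ℕ → Carrier
    f n = h * h* * q * (p ^ n - 1#) * (p ^ n - p ^ suc d)
    Δ n = h* * p ^ n * (1# - q)
    x₀ x₁ x₂ x₃ : Carrier
    x₃ = 1# - q
    x₂ = (1# - q) * (h* - θ₀*)
    x₁ = - ((1# - q) * (θ₀ - h * (1# + s * q)))
    x₀ = (h* - θ₀*) * x₁ - h * h* * (1# - q) * (p ^ d + s * q)

    -- For computing modulo the relation a = 1; b is the cofactor.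
    modulo : ∀ {x y a b} → a ≈ 1# → x ≈ y + (a - 1#) * b → x ≈ y
    modulo {x} {y} {a} {b} a≈1 x≈ = begin
      x                  ≈⟨ x≈ ⟩
      y + (a - 1#) * b   ≈⟨ +-congˡ (*-congʳ (trans (+-congʳ a≈1) (-‿inverseʳ 1#))) ⟩
      y + 0# * b         ≈⟨ trans (+-congˡ (zeroˡ b)) (+-identityʳ y) ⟩
      y                  ∎

    1-q≉0 : 1# - q ≉ 0#
    1-q≉0 1-q≈0 = qⁱ≉1 1 ℕ.≤-refl (ℕ.s≤s ℕ.z≤n) (trans (*-identityʳ q) (sym (x∙y⁻¹≈ε⇒x≈y 1# q 1-q≈0)))

    θ≈ : ∀ k → let n = toℕ k in
      θ k ≈ θ₀ + h * (1# - q ^ n) * (1# - s * (q ^ n * q)) * p ^ n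
    θ≈ k = trans (θ-eq k) (+-congˡ (*-cong
      (*-congˡ (+-congˡ (-‿cong (*-congˡ (trans (^-homo-* q n 1) (*-congˡ (*-identityʳ q)))))))
      (zpow-neg n)))
      where n = toℕ k

    θ*≈ : ∀ k → θ* k ≈ θ₀* + h* * (p ^ toℕ k - 1#)
    θ*≈ k = trans (trans (θ*-eq k) (+-congˡ (*-congˡ (zpow-neg n))))
      (modulo (qⁿq⁻ⁿ≈1 n) (solve 4 (λ t h z y → t :+ h :* (∶1 :- z) :* y
        := t :+ h :* (y :- ∶1) :+ (z :* y :- ∶1) :* (:- h)) refl θ₀* h* (q ^ n) (p ^ n)))
      where n = toℕ k

    φ≈f : ∀ k → φ k ≈ f (suc (toℕ k))
    φ≈f k = trans (trans (varphi-eq k)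
        (*-cong (*-congʳ (*-congˡ (zpow-1-2n n))) (+-congˡ (-‿cong (zpow-n-d-1 n d)))))
      (modulo (qⁿq⁻ⁿ≈1 n) (solve 5 (λ x q z y w → x :* (q :* (y :* y)) :* (∶1 :- z) :* (∶1 :- z :* w)
        := x :* q :* (y :- ∶1) :* (y :- w) :+ (z :* y :- ∶1) :* (x :* q :* (z :* y :* w :- y :+ w :- y :* w)))
        refl (h * h*) q (q ^ n) (p ^ n) (p ^ suc d)))
      where n = suc (toℕ k)

    D≈Δ : ∀ i → x₂ + x₃ * θ* i ≈ Δ (toℕ i)
    D≈Δ i = trans (+-congˡ (*-congˡ (θ*≈ i)))
      (solve 4 (λ t h q y → (∶1 :- q) :* (h :- t) :+ (∶1 :- q) :* (t :+ h :* (y :- ∶1))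
        := h :* y :* (∶1 :- q)) refl θ₀* h* q (p ^ toℕ i))

theorem9p1 : ∀ {c ℓ m ℓm} (F : Field c ℓ) → FieldNotions.IsAlgebraicallyClosed F →
    (V : VectorSpace F m ℓm) →
    let open Leonard F V in
    (d : ℕ) → 3 ≤ d → HasDimension (suc d) →
    (Φ : LeonardSystem d) (split : SplitSequences Φ) →
    IsDualqKrawtchouk Φ split ⊎ IsHahn Φ split ⊎ IsKrawtchouk Φ split →
    ZeroDiagonalSpaceNonzero Φ
theorem9p1 F _ V _ (ℕ.s≤s (ℕ.s≤s _)) _ Φ split = λ
  { (inj₁ type)        → dualqKrawtchouk type
  ; (inj₂ (inj₁ type)) → hahn type
  ; (inj₂ (inj₂ type)) → krawtchouk type
  }
  where
  open NonzeroByType F V Φ split
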